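{- Let $\varepsilon\in(0,1)$ be fixed. For every positive integer $m$, there exists $t_0=t_0(\varepsilon)$ such that for every integer $t\ge t_0$ there exists a $K_t$-minor-free graph $G$ that is not $((2-\varepsilon)tm,\,m)$-choosable.
   Context: All graphs are finite and simple. A graph is $K_t$-minor-free if $K_t$ cannot be obtained from a subgraph of it by contracting edges. A $b$-fold colouring of $G$ assigns to each vertex $v$ a set $\phi(v)$ of $b$ colours such that adjacent vertices receive disjoint sets. An $a$-list assignment of $G$ assigns to each vertex $v$ a set $L(v)$ of $a$ colours; a $b$-fold $L$-colouring is a $b$-fold colouring $\phi$ with $\phi(v)\subseteq L(v)$ for every $v$. $G$ is $(a,b)$-choosable if for every $a$-list assignment $L$ of $G$ there is a $b$-fold $L$-colouring of $G$. -}

module Defs where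

open import Algebra.Properties.Group using (⁻¹-involutive)
open import Data.Empty using (⊥)
open import Data.Fin using (Fin; punchIn; _≟_)
open import Data.Integer as ℤ using ()
open import Data.List using (List; length)
open import Data.List.Relation.Binary.Disjoint.Propositional using (Disjoint)
open import Data.List.Relation.Binary.Subset.Propositional using (_⊆_)
open import Data.List.Relation.Unary.Unique.Propositional using (Unique)
open import Data.Nat using (ℕ; zero; suc)
open import Data.Product using (Σ; ∃; _×_; _,_)
open import Data.Rational using (ℚ; 0ℚ; 1ℚ; _+_; _-_; -_; _*_; _/_; 1/_; _<_; Positive; NonZero)
open import Data.Rational.Properties using (<-dense; <-trans; ≤-<-trans; _<?_; ≮⇒≥; +-assoc; +-identityʳ; +-identityˡ; +-inverseʳ; +-monoʳ-<; neg-antimono-<; neg-distrib-+; *-assoc; *-zeroʳ; *-identityʳ; *-inverseˡ; *-monoˡ-<-pos; *-cancelʳ-<-nonNeg; normalize-nonNeg; normalize-pos; pos⇒nonZero; 1/pos⇒pos; positive⁻¹; +-0-group)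
open import Data.Sum using (_⊎_; inj₁; inj₂; [_,_]′)
open import Function.Bundles using (_⇔_; _↔_; Inverse)
open import Function.Definitions using (Injective)
open import Level using (0ℓ)
open import Relation.Binary.Core using (Rel)
open import Relation.Binary.Definitions using (Symmetric; Irreflexive; Decidable)
open import Relation.Binary.PropositionalEquality using (_≡_; _≢_; sym; trans; cong; subst; ≢-sym)
open import Relation.Nullary using (yes; no; ¬?; _×-dec_; _⊎-dec_)

-- Two-sided Dedekind cuts: lower q means q < x, and upper q means x < q.
record ℝ : Set₁ where
  field
    lower upper     : ℚ → Set
    lower-inhabited : ∃ lower
    upper-inhabited : ∃ upper
    lower-closed    : ∀ {p q} → p < q → lower q → lower p
    upper-closed    : ∀ {p q} → p < q → upper p → upper q
    lower-open      : ∀ {p} → lower p → ∃ λ q → p < q × lower q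
    upper-open      : ∀ {q} → upper q → ∃ λ p → p < q × upper p
    disjoint        : ∀ {q} → lower q → upper q → ⊥
    located         : ∀ {p q} → p < q → lower p ⊎ upper q

infix 4 _<ˡ_ _<ᵘ_

_<ˡ_ : ℚ → ℝ → Set
q <ˡ x = ℝ.lower x q

_<ᵘ_ : ℝ → ℚ → Set
x <ᵘ q = ℝ.upper x q

fromℕ : ℕ → ℚ
fromℕ n = ℤ.+ n / 1

private
  p-[p-q]≡q : ∀ p q → p - (p - q) ≡ q
  p-[p-q]≡q p q = trans (cong (p +_) (trans (neg-distrib-+ p (- q)) (cong (- p +_) (⁻¹-involutive +-0-group q))))
    (trans (sym (+-assoc p (- p) q)) (trans (cong (_+ q) (+-inverseʳ p)) (+-identityˡ q)))

  -‿antimonoʳ-< : ∀ p {q r} → q < r → p - r < p - q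
  -‿antimonoʳ-< p q<r = +-monoʳ-< p (neg-antimono-< q<r)

  p-1<p : ∀ p → p - 1ℚ < p
  p-1<p p = subst (p - 1ℚ <_) (+-identityʳ p) (+-monoʳ-< p (neg-antimono-< (positive⁻¹ 1ℚ)))

  p<p+1 : ∀ p → p < p + 1ℚ
  p<p+1 p = subst (_< p + 1ℚ) (+-identityʳ p) (+-monoʳ-< p (positive⁻¹ 1ℚ))

infixl 6 _−_
infixl 7 _·_

_−_ : ℚ → ℝ → ℝ
p − x = record
  { lower           = λ q → upper (p - q)
  ; upper           = λ q → lower (p - q)
  ; lower-inhabited = let r , x<r = upper-inhabited in p - r , subst upper (sym (p-[p-q]≡q p r)) x<r
  ; upper-inhabited = let r , r<x = lower-inhabited in p - r , subst lower (sym (p-[p-q]≡q p r)) r<x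
  ; lower-closed    = λ a<b → upper-closed (-‿antimonoʳ-< p a<b)
  ; upper-closed    = λ a<b → lower-closed (-‿antimonoʳ-< p a<b)
  ; lower-open      = λ {a} l → let r , r<p-a , x<r = upper-open l in
      p - r , subst (_< p - r) (p-[p-q]≡q p a) (-‿antimonoʳ-< p r<p-a) , subst upper (sym (p-[p-q]≡q p r)) x<r
  ; upper-open      = λ {b} u → let r , p-b<r , r<x = lower-open u in
      p - r , subst (p - r <_) (p-[p-q]≡q p b) (-‿antimonoʳ-< p p-b<r) , subst lower (sym (p-[p-q]≡q p r)) r<x
  ; disjoint        = λ l u → disjoint u l
  ; located         = λ a<b → [ inj₂ , inj₁ ]′ (located (-‿antimonoʳ-< p a<b))
  }
  where open ℝ x

_·_ : ℝ → ℕ → ℝ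
x · k = record
  { lower           = low
  ; upper           = upp
  ; lower-inhabited = let r , r<x = lower-inhabited in r * fromℕ k - 1ℚ , r , r<x , p-1<p _
  ; upper-inhabited = let r , x<r = upper-inhabited in r * fromℕ k + 1ℚ , r , x<r , p<p+1 _
  ; lower-closed    = λ a<b (r , r<x , b<rk) → r , r<x , <-trans a<b b<rk
  ; upper-closed    = λ a<b (r , x<r , rk<a) → r , x<r , <-trans rk<a a<b
  ; lower-open      = λ (r , r<x , a<rk) → let c , a<c , c<rk = <-dense a<rk in c , a<c , r , r<x , c<rk
  ; upper-open      = λ (r , x<r , rk<b) → let c , rk<c , c<b = <-dense rk<b in c , c<b , r , x<r , rk<c
  ; disjoint        = λ (r , r<x , q<rk) (s , x<s , sk<q) →
      disjoint r<x (upper-closed (*-cancelʳ-<-nonNeg (fromℕ k) {{normalize-nonNeg k 1}} (<-trans sk<q q<rk)) x<s)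
  ; located         = loc k
  }
  where
  open ℝ x

  low upp : ℚ → Set
  low q = ∃ λ r → r <ˡ x × q < r * fromℕ k
  upp q = ∃ λ r → x <ᵘ r × r * fromℕ k < q

  loc : ∀ j {p q} → p < q → (∃ λ r → r <ˡ x × p < r * fromℕ j) ⊎ (∃ λ r → x <ᵘ r × r * fromℕ j < q)
  loc zero {p} {q} p<q with p <? 0ℚ
  ... | yes p<0 = let r , r<x = lower-inhabited in inj₁ (r , r<x , subst (p <_) (sym (*-zeroʳ r)) p<0)
  ... | no  p≮0 = let r , x<r = upper-inhabited in
    inj₂ (r , x<r , subst (_< q) (sym (*-zeroʳ r)) (≤-<-trans (≮⇒≥ p≮0) p<q))
  loc (suc j) {p} {q} p<q =
    let p′ , p<p′ , p′<q  = <-dense p<q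
        q′ , p′<q′ , q′<q = <-dense p′<q
    in [ (λ l → inj₁ (p′ * κ⁻¹ , l , subst (p <_) (sym (cancel p′)) p<p′))
       , (λ u → inj₂ (q′ * κ⁻¹ , u , subst (_< q) (sym (cancel q′)) q′<q))
       ]′ (located (*-monoˡ-<-pos κ⁻¹ {{1/pos⇒pos κ}} p′<q′))
    where
    κ : ℚ
    κ = fromℕ (suc j)
    instance
      κ-pos : Positive κ
      κ-pos = normalize-pos (suc j) 1
      κ-nonZero : NonZero κ
      κ-nonZero = pos⇒nonZero κ
    κ⁻¹ : ℚ
    κ⁻¹ = 1/ κ
    cancel : ∀ r → r * κ⁻¹ * κ ≡ r
    cancel r = trans (*-assoc r κ⁻¹ κ) (trans (cong (r *_) (*-inverseˡ κ)) (*-identityʳ r))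

-- ∣a − x∣ < 1.  The integers with this property are exactly ⌊x⌋ and ⌈x⌉, hence
-- only x itself when x is an integer.
IsRoundingOf : ℕ → ℝ → Set
IsRoundingOf a x = fromℕ a - 1ℚ <ˡ x × x <ᵘ fromℕ a + 1ℚ

record Graph (n : ℕ) : Set₁ where
  field
    Adj    : Rel (Fin n) 0ℓ
    symm   : Symmetric Adj
    irrefl : Irreflexive _≡_ Adj
    adj?   : Decidable Adj

K : (t : ℕ) → Graph t
K t = record
  { Adj    = _≢_
  ; symm   = ≢-sym
  ; irrefl = λ x≡y x≢y → x≢y x≡y
  ; adj?   = λ x y → ¬? (x ≟ y)
  }

-- H is isomorphic to a (not necessarily induced) subgraph of G.
record _IsSubgraphOf_ {k n : ℕ} (H : Graph k) (G : Graph n) : Set where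
  field
    embed     : Fin k → Fin n
    injective : Injective _≡_ _≡_ embed
    preserves : ∀ {x y} → Graph.Adj H x y → Graph.Adj G (embed x) (embed y)

record _≅_ {k n : ℕ} (H : Graph k) (G : Graph n) : Set where
  field
    bijection : Fin k ↔ Fin n
    adjacency : ∀ x y → Graph.Adj H x y ⇔ Graph.Adj G (Inverse.to bijection x) (Inverse.to bijection y)

-- G / uv: the vertex v is removed, the remaining vertices being enumerated by
-- punchIn v, and u inherits the neighbours of v; no loop or multiple edge is kept.
contract : ∀ {n} (G : Graph (suc n)) (u v : Fin (suc n)) → Graph n
contract {n} G u v = record
  { Adj    = λ x y → x ≢ y × Merged (punchIn v x) (punchIn v y)
  ; symm   = λ (x≢y , e) → ≢-sym x≢y , merged-sym e
  ; irrefl = λ x≡y (x≢y , _) → x≢y x≡y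
  ; adj?   = λ x y → ¬? (x ≟ y) ×-dec merged? (punchIn v x) (punchIn v y)
  }
  where
  open Graph G
  Merged : Rel (Fin (suc n)) 0ℓ
  Merged x y = Adj x y ⊎ (x ≡ u × Adj v y) ⊎ (y ≡ u × Adj x v)

  merged-sym : Symmetric Merged
  merged-sym (inj₁ e)                = inj₁ (symm e)
  merged-sym (inj₂ (inj₁ (x≡u , e))) = inj₂ (inj₂ (x≡u , symm e))
  merged-sym (inj₂ (inj₂ (y≡u , e))) = inj₂ (inj₁ (y≡u , symm e))

  merged? : Decidable Merged
  merged? x y = adj? x y ⊎-dec ((x ≟ u ×-dec adj? v y) ⊎-dec (y ≟ u ×-dec adj? x v))

data _ContractsTo_ : ∀ {n k} → Graph n → Graph k → Set₁ where
  done : ∀ {n} {G : Graph n} → G ContractsTo G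
  step : ∀ {n k} {G : Graph (suc n)} {H : Graph k} (u v : Fin (suc n)) →
         Graph.Adj G u v → contract G u v ContractsTo H → G ContractsTo H

_IsMinorOf_ : ∀ {k n} → Graph k → Graph n → Set₁
_IsMinorOf_ {k} M G = ∃ λ h → Σ (Graph h) λ H → Σ (Graph k) λ M′ → H IsSubgraphOf G × H ContractsTo M′ × M′ ≅ M

-- Colours are natural numbers; any infinite palette gives the same notion of
-- choosability for finite graphs.
record ColourSet (k : ℕ) : Set where
  field
    colours : List ℕ
    unique  : Unique colours
    size    : length colours ≡ k

open ColourSet public using (colours)

ListAssignment : ∀ {n} → Graph n → ℕ → Set
ListAssignment {n} G a = Fin n → ColourSet a

record FoldColouring {n : ℕ} (G : Graph n) (b : ℕ) : Set where
  field
    φ      : Fin n → ColourSet b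
    proper : ∀ {u v} → Graph.Adj G u v → Disjoint (colours (φ u)) (colours (φ v))

FoldLColouring : ∀ {n a} (G : Graph n) → ListAssignment G a → ℕ → Set
FoldLColouring G L b = Σ (FoldColouring G b) λ c → ∀ v → colours (FoldColouring.φ c v) ⊆ colours (L v)

Choosable : ∀ {n} → Graph n → (a b : ℕ) → Set
Choosable G a b = (L : ListAssignment G a) → FoldLColouring G L b

{-# OPTIONS --safe #-}

-- Take two n-cliques A and B with a pseudorandom set F of non-edges between them, such that every b ∈ B
-- has few non-neighbours, but any two families of L disjoint small sets, one in A and one in B, contain
-- a pair of sets with no edge of the graph between them. For every m-fold colouring of A with fewer than
-- 2nm colours glue a copy of B onto A, where each b is denied the colours of its non-neighbours in A.
-- In the copy belonging to the actual colouring of A all 2n colour sets are disjoint, so there is no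
-- m-fold colouring from lists of size nearly 2nm. On the other hand, in a K_t-model with t a bit larger
-- than n, many branch sets miss A, hence lie in a single copy of B as they are pairwise adjacent, and
-- many branch sets miss that copy, hence meet A. Enough of both
-- kinds are small, so some two of them are not adjacent.
--
-- F comes from counting colourings A × B → Fin r; at each b the non-edges are the pairs in a colour
-- occurring at most n / r times there.
module Submission where

open import Defs
open import Data.Empty using (⊥; ⊥-elim)
open import Data.Fin using (Fin; zero; suc; toℕ; fromℕ<; cast; combine; remQuot; finToFun; funToFin; inject≤; join; splitAt; punchIn; punchOut) renaming (_≟_ to _≟ᶠ_)
open import Data.Fin.Properties using (all?; any?; ¬∀⟶∃¬; combine-injective; remQuot-combine; combine-remQuot; finToFun-funToFin; funToFin-finToFin; splitAt-join; join-splitAt; inject≤-injective; toℕ-fromℕ<; cast-involutive; punchIn-punchOut; punchOut-punchIn; punchInᵢ≢i; punchOut-cong)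
open import Data.Integer as ℤ using ()
import Data.Integer.Properties as ℤₚ
open import Data.List using (List; []; _∷_; _++_; length; map; filter; concatMap; allFin; tabulate; cartesianProduct; lookup; upTo; take)
open import Data.List.Membership.Propositional using (_∈_)
open import Data.List.Membership.Propositional.Properties using (∈-∃++; ∈-++⁺ˡ; ∈-++⁺ʳ; ∈-++⁻; ∈-filter⁺; ∈-filter⁻; ∈-allFin; ∈-concatMap⁺; ∈-concatMap⁻; ∈-cartesianProduct⁺; ∈-lookup; ∈-upTo⁺; ∈-upTo⁻; ∈-tabulate⁺)
open import Data.List.Properties using (length-++; length-++-sucʳ; length-map; length-tabulate; length-upTo; length-take; take++drop≡id)
open import Data.List.Relation.Binary.Disjoint.Propositional using (Disjoint)
open import Data.List.Relation.Binary.Subset.Propositional using (_⊆_)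
open import Data.List.Relation.Unary.All as All using (All; []; _∷_)
open import Data.List.Relation.Unary.All.Properties using () renaming (map⁺ to All-map⁺; tabulate⁺ to All-tabulate⁺)
open import Data.List.Relation.Unary.AllPairs as AllPairs using (AllPairs; []; _∷_)
open import Data.List.Relation.Unary.AllPairs.Properties using () renaming (map⁺ to AllPairs-map⁺; ++⁺ to AllPairs-++⁺; tabulate⁺ to AllPairs-tabulate⁺)
open import Data.List.Relation.Unary.Any as Any using (here; there)
open import Data.List.Relation.Unary.Any.Properties using (lookup-index)
open import Data.List.Relation.Unary.Unique.Propositional using (Unique)
open import Data.List.Relation.Unary.Unique.Propositional.Properties using (allFin⁺; upTo⁺; filter⁺; take⁺; concat⁺; ++⁺)
open import Data.Nat using (ℕ; zero; suc; pred; _+_; _*_; _^_; _/_; _≤_; _<_; _≤?_; z≤n; s≤s; ⌊_/2⌋; >-nonZero)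
open import Data.Nat.DivMod using (m/n*n≤m; m≡m%n+[m/n]*n; m%n≤n; m*n/n≡m; /-monoˡ-≤)
open import Data.Nat.Properties
open import Data.Nat.Tactic.RingSolver using (solve-∀)
open import Data.Product using (Σ; ∃; ∃₂; _×_; _,_; proj₁; proj₂; uncurry)
open import Data.Rational as ℚ using (ℚ; mkℚ; 0ℚ; 1ℚ; toℚᵘ; *<*)
import Data.Rational.Properties as ℚₚ
open import Data.Rational.Solver using (module +-*-Solver)
open import Data.Rational.Unnormalised as ℚᵘ using (ℚᵘ; mkℚᵘ; *≡*)
import Data.Rational.Unnormalised.Properties as ℚᵘₚ
open import Data.Sum using (_⊎_; inj₁; inj₂; map₂)
open import Function using (_∘_; id)
open import Function.Bundles using (Inverse; Equivalence)
open import Relation.Binary.Construct.Closure.ReflexiveTransitive as Star using (Star; _◅_; _◅◅_)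
open import Relation.Binary.PropositionalEquality
open import Relation.Nullary using (¬_; Dec; yes; no; ¬?; _×-dec_)
open import Relation.Nullary.Decidable using (decidable-stable; _→-dec_; map′)
open import Relation.Unary using (Decidable)
open import Data.List.Membership.DecPropositional _≟_ using (_∈?_)

-- Counting

module _ {A B : Set} where

  -- Delete from `ys` the partner of the head of `xs`; by injectivity of `R` no later element needs
  -- it. A relation instead of a function lets branch sets be matched directly with vertices that
  -- they contain.
  matching⇒length≤ : ∀ (R : A → B → Set) {xs ys} → Unique xs →
    (∀ {x} → x ∈ xs → ∃ λ y → y ∈ ys × R x y) →
    (∀ {x x′ y} → R x y → R x′ y → x ≡ x′) → length xs ≤ length ys
  matching⇒length≤ R [] total inj = z≤n
  matching⇒length≤ R {x ∷ xs} (x∉xs ∷ uniq) total inj with total (here refl)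
  ... | y , y∈ys , Rxy with ∈-∃++ y∈ys
  ...   | us , vs , refl = subst (suc (length xs) ≤_) (sym (length-++-sucʳ us y vs))
          (s≤s (matching⇒length≤ R uniq total′ inj))
    where
    total′ : ∀ {x′} → x′ ∈ xs → ∃ λ z → z ∈ us ++ vs × R x′ z
    total′ x′∈xs with total (there x′∈xs)
    ... | z , z∈ , Rx′z with ∈-++⁻ us z∈
    ...   | inj₁ z∈us         = z , ∈-++⁺ˡ z∈us , Rx′z
    ...   | inj₂ (here refl)  = ⊥-elim (All.lookup x∉xs x′∈xs (inj Rxy Rx′z))
    ...   | inj₂ (there z∈vs) = z , ∈-++⁺ʳ us z∈vs , Rx′z

  -- The factor `Q` clears a denominator: in the union bound each event has proportion at most a
  -- fraction with denominator `Q`.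
  length-concatMap-≤ : ∀ {f : A → List B} Q b → (∀ x → Q * length (f x) ≤ b) →
    ∀ xs → Q * length (concatMap f xs) ≤ length xs * b
  length-concatMap-≤ {f} Q b bound [] = ≤-reflexive (*-zeroʳ Q)
  length-concatMap-≤ {f} Q b bound (x ∷ xs) = begin
    Q * length (f x ++ concatMap f xs)              ≡⟨ cong (Q *_) (length-++ (f x)) ⟩
    Q * (length (f x) + length (concatMap f xs))    ≡⟨ *-distribˡ-+ Q (length (f x)) _ ⟩
    Q * length (f x) + Q * length (concatMap f xs)  ≤⟨ +-mono-≤ (bound x) (length-concatMap-≤ Q b bound xs) ⟩
    b + length xs * b                               ∎
    where open ≤-Reasoning

  length-concatMap-≥ : ∀ {f : A → List B} b xs → (∀ {x} → x ∈ xs → b ≤ length (f x)) →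
    length xs * b ≤ length (concatMap f xs)
  length-concatMap-≥ {f} b []       bound = z≤n
  length-concatMap-≥ {f} b (x ∷ xs) bound = subst (b + length xs * b ≤_) (sym (length-++ (f x)))
    (+-mono-≤ (bound (here refl)) (length-concatMap-≥ b xs (bound ∘ there)))

length-cartesianProduct : ∀ {A B : Set} (xs : List A) (ys : List B) →
  length (cartesianProduct xs ys) ≡ length xs * length ys
length-cartesianProduct []       ys = refl
length-cartesianProduct (x ∷ xs) ys = trans (length-++ (map (x ,_) ys))
  (cong₂ _+_ (length-map (x ,_) ys) (length-cartesianProduct xs ys))

unique-⊆⇒length≤ : ∀ {A : Set} {xs ys : List A} → Unique xs → xs ⊆ ys → length xs ≤ length ys
unique-⊆⇒length≤ uniq xs⊆ys =
  matching⇒length≤ _≡_ uniq (λ x∈xs → _ , xs⊆ys x∈xs , refl) (λ p q → trans p (sym q))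

length-filter-¬ : ∀ {A : Set} {P : A → Set} (P? : Decidable P) xs →
  length (filter P? xs) + length (filter (¬? ∘ P?) xs) ≡ length xs
length-filter-¬ P? [] = refl
length-filter-¬ P? (x ∷ xs) with P? x
... | yes _ = cong suc (length-filter-¬ P? xs)
... | no  _ = trans (+-suc _ _) (cong suc (length-filter-¬ P? xs))

length-allFin : ∀ n → length (allFin n) ≡ n
length-allFin n = length-tabulate {n = n} _

satisfying : ∀ {n} {P : Fin n → Set} → Decidable P → List (Fin n)
satisfying P? = filter P? (allFin _)

count : ∀ {n} {P : Fin n → Set} → Decidable P → ℕ
count P? = length (satisfying P?)

module _ {n} {P : Fin n → Set} (P? : Decidable P) where

  satisfying-unique : Unique (satisfying P?)
  satisfying-unique = filter⁺ P? (allFin⁺ n)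

  ∈-satisfying⁺ : ∀ {x} → P x → x ∈ satisfying P?
  ∈-satisfying⁺ = ∈-filter⁺ P? (∈-allFin _)

  ∈-satisfying⁻ : ∀ {x} → x ∈ satisfying P? → P x
  ∈-satisfying⁻ x∈ = proj₂ (∈-filter⁻ P? {xs = allFin n} x∈)

count-mono : ∀ {n} {P Q : Fin n → Set} (P? : Decidable P) (Q? : Decidable Q) →
  (∀ {x} → P x → Q x) → count P? ≤ count Q?
count-mono P? Q? P⇒Q = unique-⊆⇒length≤ (satisfying-unique P?)
  (∈-satisfying⁺ Q? ∘ P⇒Q ∘ ∈-satisfying⁻ P?)

count≤n : ∀ {n} {P : Fin n → Set} (P? : Decidable P) → count P? ≤ n
count≤n {n} P? = subst (count P? ≤_) (length-allFin n)
  (unique-⊆⇒length≤ (satisfying-unique P?) (λ _ → ∈-allFin _))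

count-⊎-≤ : ∀ {n} {P Q R : Fin n → Set} (P? : Decidable P) (Q? : Decidable Q) (R? : Decidable R) →
  (∀ {x} → P x → R x) → (∀ {x} → Q x → R x) → (∀ {x} → P x → Q x → ⊥) → count P? + count Q? ≤ count R?
count-⊎-≤ P? Q? R? P⇒R Q⇒R disj = subst (_≤ count R?) (length-++ (satisfying P?))
  (unique-⊆⇒length≤
    (++⁺ (satisfying-unique P?) (satisfying-unique Q?)
      (λ (p , q) → disj (∈-satisfying⁻ P? p) (∈-satisfying⁻ Q? q)))
    (λ x∈ → ∈-satisfying⁺ R? (case x∈)))
  where
  case : ∀ {x} → x ∈ satisfying P? ++ satisfying Q? → _
  case x∈ with ∈-++⁻ (satisfying P?) x∈
  ... | inj₁ p = P⇒R (∈-satisfying⁻ P? p)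
  ... | inj₂ q = Q⇒R (∈-satisfying⁻ Q? q)

-- If every point is bad for some event, the lists of bad points together contain the whole space,
-- so their lengths add up to at least `T`.
union-bound : ∀ {T E} Q b {Bad : Fin E → Fin T → Set} (bad? : ∀ e → Decidable (Bad e)) →
  (∀ e → Q * count (bad? e) ≤ b) → (∀ x → ∃ λ e → Bad e x) → Q * T ≤ E * b
union-bound {T} {E} Q b bad? bound cover = begin
  Q * T                                                  ≡⟨ cong (Q *_) (length-allFin T) ⟨
  Q * length (allFin T)                                  ≤⟨ *-monoʳ-≤ Q (unique-⊆⇒length≤ (allFin⁺ T) λ {x} _ → covered x) ⟩
  Q * length (concatMap (satisfying ∘ bad?) (allFin E))  ≤⟨ length-concatMap-≤ Q b bound (allFin E) ⟩
  length (allFin E) * b                                  ≡⟨ cong (_* b) (length-allFin E) ⟩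
  E * b                                                  ∎
  where
  open ≤-Reasoning
  covered : ∀ x → x ∈ concatMap (satisfying ∘ bad?) (allFin E)
  covered x = let e , bad = cover x in
    ∈-concatMap⁺ _ (Any.map (λ { refl → ∈-satisfying⁺ (bad? e) bad }) (∈-allFin e))

-- Functions are coded as numbers below `m ^ n`, which makes them countable by `allFin`; pointwise
-- agreement takes the place of equality of functions.
finToFun-injective : ∀ {m n} {x y : Fin (m ^ n)} → (∀ i → finToFun {m} {n} x i ≡ finToFun y i) → x ≡ y
finToFun-injective {m} {n} {x} {y} eq =
  trans (sym (funToFin-finToFin {n} {m} x)) (trans (funToFin-cong n eq) (funToFin-finToFin {n} {m} y))
  where
  funToFin-cong : ∀ k {f g : Fin k → Fin m} → (∀ i → f i ≡ g i) → funToFin f ≡ funToFin g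
  funToFin-cong zero    eq = refl
  funToFin-cong (suc k) eq = cong₂ combine (eq zero) (funToFin-cong k (eq ∘ suc))

-- Functions that miss a given pattern on disjoint blocks

module Blocks {M r κ : ℕ} (g : Fin M → Fin r) where

  -- A block lists `κ` positions, possibly with repetitions; `g` is the pattern that a function has
  -- to show there in order to hit it.
  Block : Set
  Block = Fin κ → Fin M

  Separate : Block → Block → Set
  Separate S S′ = ∀ i j → S i ≢ S′ j

  Hit : Block → Fin (r ^ M) → Set
  Hit S x = ∀ i → finToFun {r} {M} x (S i) ≡ g (S i)

  hit? : ∀ S → Decidable (Hit S)
  hit? S x = all? λ i → finToFun x (S i) ≟ᶠ g (S i)

  Miss : List Block → Fin (r ^ M) → Set
  Miss Ss x = All (λ S → ¬ Hit S x) Ss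

  miss? : ∀ Ss → Decidable (Miss Ss)
  miss? Ss x = All.all? (λ S → ¬? (hit? S x)) Ss

  missHit? : ∀ S Ss → Decidable (λ x → Miss Ss x × Hit S x)
  missHit? S Ss x = miss? Ss x ×-dec hit? S x

  overwriteFun : Block → Fin (r ^ M) → Fin M → Fin r
  overwriteFun S x s with any? (λ i → S i ≟ᶠ s)
  ... | yes _ = g s
  ... | no  _ = finToFun x s

  overwrite : Block → Fin (r ^ M) → Fin (r ^ M)
  overwrite S x = funToFin (overwriteFun S x)

  overwriteFun-hit : ∀ S x i → overwriteFun S x (S i) ≡ g (S i)
  overwriteFun-hit S x i with any? (λ j → S j ≟ᶠ S i)
  ... | yes _ = refl
  ... | no ¬h = ⊥-elim (¬h (i , refl))

  overwriteFun-outside : ∀ S x s → (∀ i → S i ≢ s) → overwriteFun S x s ≡ finToFun x s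
  overwriteFun-outside S x s out with any? (λ j → S j ≟ᶠ s)
  ... | yes (j , eq) = ⊥-elim (out j eq)
  ... | no _         = refl

  overwrite-hit : ∀ S x → Hit S (overwrite S x)
  overwrite-hit S x i = trans (finToFun-funToFin (overwriteFun S x) (S i)) (overwriteFun-hit S x i)

  overwrite-miss : ∀ S x {Ss} → All (Separate S) Ss → Miss Ss x → Miss Ss (overwrite S x)
  overwrite-miss S x []           []            = []
  overwrite-miss S x (sep ∷ seps) (miss ∷ misses) =
    (λ hit → miss λ i → trans (sym (overwriteFun-outside S x _ (λ j → sep j i)))
      (trans (sym (finToFun-funToFin (overwriteFun S x) _)) (hit i)))
    ∷ overwrite-miss S x seps misses

  restriction : Block → Fin (r ^ M) → Fin (r ^ κ)
  restriction S x = funToFin (finToFun {r} {M} x ∘ S)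

  -- Overwriting forgets only the values on `S`, and the restriction records exactly these.
  resample-injective : ∀ S {x y} → overwrite S x ≡ overwrite S y → restriction S x ≡ restriction S y → x ≡ y
  resample-injective S {x} {y} eq eq′ = finToFun-injective {r} {M} same
    where
    same : ∀ s → finToFun x s ≡ finToFun y s
    same s with any? (λ i → S i ≟ᶠ s)
    ... | yes (i , refl) = trans (sym (finToFun-funToFin (finToFun {r} {M} x ∘ S) i))
          (trans (cong (λ z → finToFun z i) eq′) (finToFun-funToFin (finToFun {r} {M} y ∘ S) i))
    ... | no out = trans (sym (at x)) (trans (cong (λ z → finToFun z s) eq) (at y))
      where
      at : ∀ z → finToFun (overwrite S z) s ≡ finToFun z s
      at z = trans (finToFun-funToFin (overwriteFun S z) s) (overwriteFun-outside S z s (λ i e → out (i , e)))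

  -- The injection sends `x` to its restriction to `S` together with `overwrite S x`. The latter
  -- still misses every block of `Ss`, because these are separate from `S`.
  miss-≤ : ∀ S Ss → All (Separate S) Ss → count (miss? Ss) ≤ r ^ κ * count (missHit? S Ss)
  miss-≤ S Ss seps = subst (count (miss? Ss) ≤_)
    (trans (length-cartesianProduct (allFin (r ^ κ)) _) (cong (_* count (missHit? S Ss)) (length-allFin (r ^ κ))))
    (matching⇒length≤ (λ x (u , z) → restriction S x ≡ u × overwrite S x ≡ z)
      (satisfying-unique (miss? Ss))
      (λ {x} x∈ → (restriction S x , overwrite S x) ,
        ∈-cartesianProduct⁺ (∈-allFin _) (∈-satisfying⁺ (missHit? S Ss)
          (overwrite-miss S x seps (∈-satisfying⁻ (miss? Ss) x∈) , overwrite-hit S x)) ,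
        refl , refl)
      (λ (p , p′) (q , q′) → resample-injective S (trans p′ (sym q′)) (trans p (sym q))))

  -- A block is hit by at least a 1/(1+q) fraction of the functions that miss the others:
  -- overwriting it with g costs at most its r ^ κ ≤ 1+q former contents.
  miss-bound : ∀ {q} → r ^ κ ≤ suc q → ∀ Ss → AllPairs Separate Ss →
    suc q ^ length Ss * count (miss? Ss) ≤ q ^ length Ss * r ^ M
  miss-bound r^κ≤q [] [] = *-monoʳ-≤ 1 (count≤n (miss? []))
  miss-bound {q} r^κ≤q (S ∷ Ss) (sep ∷ seps) = begin
    suc q * suc q ^ length Ss * N     ≡⟨ cong (_* N) (*-comm (suc q) (suc q ^ length Ss)) ⟩
    suc q ^ length Ss * suc q * N     ≡⟨ *-assoc (suc q ^ length Ss) (suc q) N ⟩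
    suc q ^ length Ss * (suc q * N)   ≤⟨ *-monoʳ-≤ (suc q ^ length Ss) per-block ⟩
    suc q ^ length Ss * (q * N′)      ≡⟨ *-assoc (suc q ^ length Ss) q N′ ⟨
    suc q ^ length Ss * q * N′        ≡⟨ cong (_* N′) (*-comm (suc q ^ length Ss) q) ⟩
    q * suc q ^ length Ss * N′        ≡⟨ *-assoc q (suc q ^ length Ss) N′ ⟩
    q * (suc q ^ length Ss * N′)      ≤⟨ *-monoʳ-≤ q (miss-bound r^κ≤q Ss seps) ⟩
    q * (q ^ length Ss * r ^ M)       ≡⟨ *-assoc q (q ^ length Ss) (r ^ M) ⟨
    q * q ^ length Ss * r ^ M         ∎
    where
    open ≤-Reasoning
    N N′ H : ℕ
    N  = count (miss? (S ∷ Ss))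
    N′ = count (miss? Ss)
    H  = count (missHit? S Ss)
    split : N + H ≤ N′
    split = count-⊎-≤ (miss? (S ∷ Ss)) (missHit? S Ss) (miss? Ss)
      All.tail proj₁ (λ miss (_ , hit) → All.head miss hit)
    per-block : suc q * N ≤ q * N′
    -- `N′` is added on both sides since it is at most `suc q * H`; the two counts then combine to
    -- `N + H`, which is at most `N′`.
    per-block = +-cancelʳ-≤ N′ (suc q * N) (q * N′) (begin
      suc q * N + N′         ≤⟨ +-monoʳ-≤ (suc q * N) (≤-trans (miss-≤ S Ss sep) (*-monoˡ-≤ H r^κ≤q)) ⟩
      suc q * N + suc q * H  ≡⟨ *-distribˡ-+ (suc q) N H ⟨
      suc q * (N + H)        ≤⟨ *-monoʳ-≤ (suc q) split ⟩
      N′ + q * N′            ≡⟨ +-comm N′ (q * N′) ⟩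
      q * N′ + N′            ∎)

-- Random colourings of A × B

Separated : ∀ {n k L} → (Fin L → Fin k → Fin n) → Set
Separated X = ∀ i j x y → X i x ≡ X j y → i ≡ j

separated? : ∀ {n k L} (X : Fin L → Fin k → Fin n) → Dec (Separated X)
separated? X = all? λ i → all? λ j → all? λ x → all? λ y → (X i x ≟ᶠ X j y) →-dec (i ≟ᶠ j)

-- f is a colouring of the pairs A × B; colour c b selects the non-edges at b ∈ B.
Unavoidable : ∀ {n r} (k L : ℕ) → (Fin n → Fin n → Fin r) → Set
Unavoidable {n} {r} k L f = (c : Fin n → Fin r) (X Y : Fin L → Fin k → Fin n) → Separated X → Separated Y →
  ∃₂ λ i j → ∀ x y → f (X i x) (Y j y) ≡ c (Y j y)

module RandomColouring (n k L r q : ℕ) (r^k²≤1+q : r ^ (k * k) ≤ suc q) where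

  Family : Set
  Family = Fin L → Fin k → Fin n

  -- An event is a code for two families and a selection of colours. Codes of overlapping families
  -- are counted as well; `Bad` demands separation, so their events are empty.
  events : ℕ
  events = (n ^ k) ^ L * (n ^ k) ^ L * r ^ n

  family : Fin ((n ^ k) ^ L) → Family
  family z i = finToFun {n} {k} (finToFun {n ^ k} {L} z i)

  encodeFamily : Family → Fin ((n ^ k) ^ L)
  encodeFamily X = funToFin (funToFin ∘ X)

  family-encode : ∀ X i x → family (encodeFamily X) i x ≡ X i x
  family-encode X i x = trans (cong (λ z → finToFun {n} {k} z x) (finToFun-funToFin (funToFin ∘ X) i))
    (finToFun-funToFin (X i) x)

  encode : Family → Family → (Fin n → Fin r) → Fin events
  encode X Y c = combine (combine (encodeFamily X) (encodeFamily Y)) (funToFin c)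

  codes : Fin events → Fin ((n ^ k) ^ L * (n ^ k) ^ L) × Fin (r ^ n)
  codes = remQuot (r ^ n)

  familyX familyY : Fin events → Family
  familyX e = family (proj₁ (remQuot {(n ^ k) ^ L} ((n ^ k) ^ L) (proj₁ (codes e))))
  familyY e = family (proj₂ (remQuot {(n ^ k) ^ L} ((n ^ k) ^ L) (proj₁ (codes e))))

  selection : Fin events → Fin n → Fin r
  selection e = finToFun {r} {n} (proj₂ (codes e))

  module _ (X Y : Family) (c : Fin n → Fin r) where

    private
      codes-encode : codes (encode X Y c) ≡ (combine (encodeFamily X) (encodeFamily Y) , funToFin c)
      codes-encode = remQuot-combine (combine (encodeFamily X) (encodeFamily Y)) (funToFin c)

      pair-encode : remQuot {(n ^ k) ^ L} ((n ^ k) ^ L) (proj₁ (codes (encode X Y c))) ≡ (encodeFamily X , encodeFamily Y)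
      pair-encode = trans (cong (remQuot {(n ^ k) ^ L} ((n ^ k) ^ L) ∘ proj₁) codes-encode)
        (remQuot-combine (encodeFamily X) (encodeFamily Y))

    familyX-encode : ∀ i x → familyX (encode X Y c) i x ≡ X i x
    familyX-encode i x = trans (cong (λ z → family (proj₁ z) i x) pair-encode) (family-encode X i x)

    familyY-encode : ∀ i x → familyY (encode X Y c) i x ≡ Y i x
    familyY-encode i x = trans (cong (λ z → family (proj₂ z) i x) pair-encode) (family-encode Y i x)

    selection-encode : ∀ b → selection (encode X Y c) b ≡ c b
    selection-encode b = trans (cong (λ z → finToFun (proj₂ z) b) codes-encode) (finToFun-funToFin c b)

  target : Fin events → Fin (n * n) → Fin r
  target e s = selection e (proj₂ (remQuot {n} n s))

  module At (e : Fin events) = Blocks {n * n} {r} {k * k} (target e)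

  -- The rectangle of all pairs from `X i` and `Y j`, as positions in `Fin (n * n)`. Hitting it
  -- means that each pair has the colour selected at its second entry.
  block : Family → Family → Fin L → Fin L → Fin (k * k) → Fin (n * n)
  block X Y i j s = combine (X i (proj₁ (remQuot {k} k s))) (Y j (proj₂ (remQuot {k} k s)))

  blocks : Fin events → List (Fin (k * k) → Fin (n * n))
  blocks e = tabulate {n = L * L} λ z →
    block (familyX e) (familyY e) (proj₁ (remQuot {L} L z)) (proj₂ (remQuot {L} L z))

  Bad : Fin events → Fin (r ^ (n * n)) → Set
  Bad e x = (Separated (familyX e) × Separated (familyY e)) × At.Miss e (blocks e) x

  bad? : ∀ e → Decidable (Bad e)
  bad? e x = (separated? (familyX e) ×-dec separated? (familyY e)) ×-dec At.miss? e (blocks e) x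

  blocks-separate : ∀ e → Separated (familyX e) → Separated (familyY e) → AllPairs (At.Separate e) (blocks e)
  blocks-separate e sepX sepY = AllPairs-tabulate⁺ λ {z} {z′} z≢z′ s s′ eq →
    let eqX , eqY = combine-injective (familyX e _ _) (familyY e _ _) (familyX e _ _) (familyY e _ _) eq in
    z≢z′ (trans (sym (combine-remQuot {L} L z))
      (trans (cong₂ combine (sepX _ _ _ _ eqX) (sepY _ _ _ _ eqY)) (combine-remQuot {L} L z′)))

  -- For separated families the `L * L` rectangles are pairwise disjoint, and `miss-bound` applies
  -- to all of them; otherwise nothing is bad.
  bad-bound : ∀ e → suc q ^ (L * L) * count (bad? e) ≤ q ^ (L * L) * r ^ (n * n)
  bad-bound e = bound (separated? (familyX e) ×-dec separated? (familyY e))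
    where
    open ≤-Reasoning
    bound : Dec (Separated (familyX e) × Separated (familyY e)) → _
    bound (yes (sepX , sepY)) = begin
      suc q ^ (L * L) * count (bad? e)                 ≤⟨ *-monoʳ-≤ (suc q ^ (L * L)) (count-mono (bad? e) (At.miss? e (blocks e)) proj₂) ⟩
      suc q ^ (L * L) * count (At.miss? e (blocks e))  ≡⟨ cong (λ ℓ → suc q ^ ℓ * count (At.miss? e (blocks e))) (length-tabulate {n = L * L} _) ⟨
      suc q ^ length (blocks e) * count (At.miss? e (blocks e))
        ≤⟨ At.miss-bound e r^k²≤1+q (blocks e) (blocks-separate e sepX sepY) ⟩
      q ^ length (blocks e) * r ^ (n * n)              ≡⟨ cong (λ ℓ → q ^ ℓ * r ^ (n * n)) (length-tabulate {n = L * L} _) ⟩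
      q ^ (L * L) * r ^ (n * n)                        ∎
    bound (no ¬sep) = begin
      suc q ^ (L * L) * count (bad? e)  ≤⟨ *-monoʳ-≤ (suc q ^ (L * L)) (count-mono (bad? e) (λ _ → no λ ()) (¬sep ∘ proj₁)) ⟩
      suc q ^ (L * L) * count {r ^ (n * n)} (λ _ → no (λ ()))  ≡⟨ cong (suc q ^ (L * L) *_) (none (allFin (r ^ (n * n)))) ⟩
      suc q ^ (L * L) * 0               ≡⟨ *-zeroʳ (suc q ^ (L * L)) ⟩
      0                                 ≤⟨ z≤n ⟩
      q ^ (L * L) * r ^ (n * n)         ∎
      where
      none : ∀ {A : Set} (xs : List A) → length (filter {P = λ _ → ⊥} (λ _ → no λ ()) xs) ≡ 0
      none []       = refl
      none (_ ∷ xs) = none xs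

  colouring : Fin (r ^ (n * n)) → Fin n → Fin n → Fin r
  colouring x a b = finToFun {r} {n * n} x (combine a b)

  -- Given `X`, `Y` and `c`, apply the hypothesis to their code. Decoding returns them only
  -- pointwise, so separation and hits have to be carried across.
  ¬bad⇒unavoidable : ∀ x → (∀ e → ¬ Bad e x) → Unavoidable k L (colouring x)
  ¬bad⇒unavoidable x good c X Y sepX sepY
    with any? (λ i → any? λ j → all? λ u → all? λ v → colouring x (X i u) (Y j v) ≟ᶠ c (Y j v))
  ... | yes found = found
  ... | no  none  = ⊥-elim (good e
      ( ( (λ i j u v eq → sepX i j u v (trans (sym (eX i u)) (trans eq (eX j v))))
        , (λ i j u v eq → sepY i j u v (trans (sym (eY i u)) (trans eq (eY j v)))))
      , All-tabulate⁺ λ z hit → none (_ , _ , λ u v → unblock (proj₁ (remQuot {L} L z)) (proj₂ (remQuot {L} L z)) hit u v)))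
    where
    e : Fin events
    e = encode X Y c
    eX = familyX-encode X Y c
    eY = familyY-encode X Y c
    unblock : ∀ i j → At.Hit e (block (familyX e) (familyY e) i j) x → ∀ u v → colouring x (X i u) (Y j v) ≡ c (Y j v)
    unblock i j hit u v = begin
      colouring x (X i u) (Y j v)                        ≡⟨ cong₂ (colouring x) (eX i u) (eY j v) ⟨
      colouring x (familyX e i u) (familyY e j v)        ≡⟨ cong (λ (u , v) → colouring x (familyX e i u) (familyY e j v)) (remQuot-combine u v) ⟨
      finToFun x (block (familyX e) (familyY e) i j (combine u v)) ≡⟨ hit (combine u v) ⟩
      target e (block (familyX e) (familyY e) i j (combine u v)) ≡⟨ cong (λ z → selection e (proj₂ z)) (remQuot-combine {n} (familyX e i _) (familyY e j _)) ⟩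
      selection e (familyY e j (proj₂ (remQuot {k} k (combine u v)))) ≡⟨ cong (λ z → selection e (familyY e j (proj₂ z))) (remQuot-combine u v) ⟩
      selection e (familyY e j v)                        ≡⟨ selection-encode X Y c _ ⟩
      c (familyY e j v)                                  ≡⟨ cong c (eY j v) ⟩
      c (Y j v)                                          ∎
      where open ≡-Reasoning

  -- If every colouring were bad for some event, the union bound would contradict the small number
  -- of events.
  unavoidable-exists : events * q ^ (L * L) < suc q ^ (L * L) → 1 ≤ r → ∃ λ (f : Fin n → Fin n → Fin r) → Unavoidable k L f
  unavoidable-exists few 1≤r with any? (λ x → all? λ e → ¬? (bad? e x))
  ... | yes (x , good) = colouring x , ¬bad⇒unavoidable x good
  ... | no  none = ⊥-elim (<-irrefl refl (begin-strict
      suc q ^ (L * L) * r ^ (n * n)             ≤⟨ union-bound (suc q ^ (L * L)) _ bad? bad-bound cover ⟩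
      events * (q ^ (L * L) * r ^ (n * n))      ≡⟨ *-assoc events (q ^ (L * L)) (r ^ (n * n)) ⟨
      events * q ^ (L * L) * r ^ (n * n)        <⟨ *-monoˡ-< (r ^ (n * n)) {{m^n≢0 r (n * n) {{>-nonZero 1≤r}}}} few ⟩
      suc q ^ (L * L) * r ^ (n * n)             ∎))
    where
    open ≤-Reasoning
    cover : ∀ x → ∃ λ e → Bad e x
    cover x = let e , ¬¬bad = ¬∀⟶∃¬ events _ (λ e → ¬? (bad? e x)) (λ good → none (x , good)) in
      e , decidable-stable (bad? e x) ¬¬bad

-- Branch sets of a minor

-- `branch` is total because vertices are dropped only in passing to the subgraph `H`; contraction
-- itself merges vertices and loses none.
record Model {h t} (H : Graph h) (M : Graph t) : Set where
  field
    branch    : Fin h → Fin t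
    nonempty  : ∀ i → ∃ λ x → branch x ≡ i
    touching  : ∀ {i j} → Graph.Adj M i j → ∃₂ λ x y → branch x ≡ i × branch y ≡ j × Graph.Adj H x y
    connected : ∀ {x y} → branch x ≡ branch y → Star (λ u v → Graph.Adj H u v × branch u ≡ branch v) x y

module Contraction {n} (G : Graph (suc n)) (u v : Fin (suc n)) (uv : Graph.Adj G u v) where
  open Graph G

  v≢u : v ≢ u
  v≢u v≡u = irrefl (sym v≡u) uv

  -- The quotient map of the contraction: `v` goes to the image of `u`, every other vertex to
  -- itself.
  project : Fin (suc n) → Fin n
  project w with v ≟ᶠ w
  ... | yes _   = punchOut v≢u
  ... | no  v≢w = punchOut v≢w

  project-merged : project v ≡ project u
  project-merged with v ≟ᶠ v | v ≟ᶠ u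
  ... | no v≢v | _       = ⊥-elim (v≢v refl)
  ... | yes _  | yes v≡u = ⊥-elim (v≢u v≡u)
  ... | yes _  | no  _   = punchOut-cong v refl

  project-punchIn : ∀ x → project (punchIn v x) ≡ x
  project-punchIn x with v ≟ᶠ punchIn v x
  ... | yes eq = ⊥-elim (punchInᵢ≢i v x (sym eq))
  ... | no  _  = trans (punchOut-cong v refl) (punchOut-punchIn v {x})

  punchIn-project : ∀ {w} → v ≢ w → punchIn v (project w) ≡ w
  punchIn-project {w} v≢w with v ≟ᶠ w
  ... | yes v≡w = ⊥-elim (v≢w v≡w)
  ... | no  v≢w = punchIn-punchOut v≢w

  project-injective : ∀ {a b} → v ≢ a → v ≢ b → project a ≡ project b → a ≡ b
  project-injective v≢a v≢b eq =
    trans (sym (punchIn-project v≢a)) (trans (cong (punchIn v) eq) (punchIn-project v≢b))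

  lift-edge : ∀ {x y} → Graph.Adj (contract G u v) x y → ∃₂ λ a b → project a ≡ x × project b ≡ y × Adj a b
  lift-edge {x} {y} (_ , inj₁ e) = _ , _ , project-punchIn x , project-punchIn y , e
  lift-edge {x} {y} (_ , inj₂ (inj₁ (x≡u , e))) =
    v , _ , trans project-merged (trans (cong project (sym x≡u)) (project-punchIn x)) , project-punchIn y , e
  lift-edge {x} {y} (_ , inj₂ (inj₂ (y≡u , e))) =
    _ , v , project-punchIn x , trans project-merged (trans (cong project (sym y≡u)) (project-punchIn y)) , e

  -- Branch sets are pulled back along `project`. They stay connected because the only fibre with
  -- two elements is that of `u` and `v`, which are adjacent.
  lift-model : ∀ {t} {M : Graph t} → Model (contract G u v) M → Model G M
  lift-model {t} {M} model = record
    { branch    = β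
    ; nonempty  = λ i → let x , eq = nonempty i in punchIn v x , trans (cong branch (project-punchIn x)) eq
    ; touching  = λ e → let x , y , x∈i , y∈j , xy = touching e
                            a , b , a→x , b→y , ab = lift-edge xy
                        in a , b , trans (cong branch a→x) x∈i , trans (cong branch b→y) y∈j , ab
    ; connected = λ same → lift-path (connected same) refl refl
    }
    where
    open Model model
    β : Fin (suc n) → Fin t
    β = branch ∘ project
    Path : Fin (suc n) → Fin (suc n) → Set
    Path = Star λ a b → Adj a b × β a ≡ β b

    fibre′ : ∀ {a b} → Dec (v ≡ a) → Dec (v ≡ b) → project a ≡ project b → Path a b
    fibre′ (yes refl) (yes refl) eq = Star.ε
    fibre′ (no v≢a)   (no v≢b)   eq = subst (Path _) (project-injective v≢a v≢b eq) Star.ε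
    fibre′ (yes refl) (no v≢b)   eq with refl ← project-injective v≢u v≢b (trans (sym project-merged) eq) =
      (symm uv , cong branch project-merged) ◅ Star.ε
    fibre′ (no v≢a)   (yes refl) eq with refl ← project-injective v≢a v≢u (trans eq project-merged) =
      (uv , cong branch (sym project-merged)) ◅ Star.ε

    fibre : ∀ {a b} → project a ≡ project b → Path a b
    fibre {a} {b} = fibre′ (v ≟ᶠ a) (v ≟ᶠ b)

    lift-path : ∀ {x y} → Star (λ a b → Graph.Adj (contract G u v) a b × branch a ≡ branch b) x y →
      ∀ {a b} → project a ≡ x → project b ≡ y → Path a b
    lift-path Star.ε a→x b→x = fibre (trans a→x (sym b→x))
    lift-path ((e , same) ◅ path) a→x b→y =
      let a′ , b′ , a′→x , b′→z , a′b′ = lift-edge e in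
      fibre (trans a→x (sym a′→x)) ◅◅
      (a′b′ , trans (cong branch a′→x) (trans same (cong branch (sym b′→z)))) ◅ lift-path path b′→z b→y

contracts⇒model : ∀ {h t} {H : Graph h} {M : Graph t} → H ContractsTo M → Model H M
contracts⇒model {H = H} done = record
  { branch    = id
  ; nonempty  = λ i → i , refl
  ; touching  = λ e → _ , _ , refl , refl , e
  ; connected = λ { refl → Star.ε }
  }
contracts⇒model (step u v uv rest) = Contraction.lift-model _ u v uv (contracts⇒model rest)

model-≅ : ∀ {h s t} {H : Graph h} {M : Graph s} {M′ : Graph t} → M ≅ M′ → Model H M → Model H M′
model-≅ {H = H} {M} {M′} iso model = record
  { branch    = to ∘ branch
  ; nonempty  = λ i → let x , eq = nonempty (from i) in x , trans (cong to eq) (strictlyInverseˡ i)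
  ; touching  = λ {i} {j} e →
      let x , y , x∈ , y∈ , xy = touching (Equivalence.from (adjacency (from i) (from j))
            (subst₂ (Graph.Adj M′) (sym (strictlyInverseˡ i)) (sym (strictlyInverseˡ j)) e))
      in x , y , trans (cong to x∈) (strictlyInverseˡ i) , trans (cong to y∈) (strictlyInverseˡ j) , xy
  ; connected = λ {x} {y} same → Star.map (λ (e , eq) → e , cong to eq)
      (connected (trans (sym (strictlyInverseʳ (branch x))) (trans (cong from same) (strictlyInverseʳ (branch y)))))
  }
  where
  open Model model
  open _≅_ iso
  open Inverse bijection using (to; from; strictlyInverseˡ; strictlyInverseʳ)

-- The graph and its minors

lookup-injective : ∀ {A : Set} {xs : List A} → Unique xs → ∀ {i j} → lookup xs i ≡ lookup xs j → i ≡ j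
lookup-injective (x∉ ∷ uniq) {zero}  {zero}  eq = refl
lookup-injective (x∉ ∷ uniq) {zero}  {suc j} eq = ⊥-elim (All.lookup x∉ (∈-lookup j) eq)
lookup-injective (x∉ ∷ uniq) {suc i} {zero}  eq = ⊥-elim (All.lookup x∉ (∈-lookup i) (sym eq))
lookup-injective (x∉ ∷ uniq) {suc i} {suc j} eq = cong suc (lookup-injective uniq eq)

-- The default `d` pads a short list to `k` places. Repetitions are harmless, since `Separated`
-- compares only sets with different indices.
enumerate : ∀ {A : Set} {k} → A → List A → Fin k → A
enumerate d []       _       = d
enumerate d (x ∷ xs) zero    = x
enumerate d (x ∷ xs) (suc i) = enumerate d xs i

enumerate-∈ : ∀ {A : Set} {k} {d : A} {xs} → d ∈ xs → ∀ (i : Fin k) → enumerate d xs i ∈ xs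
enumerate-∈ {A} {xs = ys} d∈ = go (λ x∈ → x∈)
  where
  go : ∀ {xs k} → (∀ {x} → x ∈ xs → x ∈ ys) → ∀ (i : Fin k) → enumerate _ xs i ∈ ys
  go {[]}     ⊆ys i       = d∈
  go {x ∷ xs} ⊆ys zero    = ⊆ys (here refl)
  go {x ∷ xs} ⊆ys (suc i) = go (⊆ys ∘ there) i

enumerate-covers : ∀ {A : Set} {k} {d : A} {xs x} → length xs ≤ k → x ∈ xs → ∃ λ (i : Fin k) → enumerate d xs i ≡ x
enumerate-covers (s≤s len) (here refl) = zero , refl
enumerate-covers (s≤s len) (there x∈)  = let i , eq = enumerate-covers len x∈ in suc i , eq

record SmallFamily {t n} (k L : ℕ) (P : Fin t → Fin n → Set) (I : List (Fin t)) : Set where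
  field
    index     : Fin L → Fin t
    index∈    : ∀ l → index l ∈ I
    family    : Fin L → Fin k → Fin n
    family⊆   : ∀ l x → P (index l) (family l x)
    covers    : ∀ l {y} → P (index l) y → ∃ λ x → family l x ≡ y
    separated : Separated family

-- At most L of the disjoint sets P i have more than k ≥ n / L elements, the others provide the family.
small-family : ∀ {t n} k L (P : Fin t → Fin n → Set) → (∀ i → Decidable (P i)) →
  (∀ {i j x} → P i x → P j x → i ≡ j) → (I : List (Fin t)) → Unique I → (∀ {i} → i ∈ I → ∃ (P i)) →
  L + L ≤ length I → n ≤ k * L → SmallFamily k L P I
small-family {t} {n} k L P P? disj I uniq nonempty 2L≤I n≤kL = record
  { index     = index
  ; index∈    = λ l → proj₁ (index∈small l)
  ; family    = λ l → enumerate (default l) (members (index l))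
  ; family⊆   = λ l x → ∈-satisfying⁻ (P? (index l)) (enumerate-∈ (default∈ l) x)
  ; covers    = λ l p → enumerate-covers (proj₂ (index∈small l)) (∈-satisfying⁺ (P? (index l)) p)
  ; separated = λ l l′ x y eq → index-injective (disj
      (∈-satisfying⁻ (P? (index l)) (enumerate-∈ (default∈ l) x))
      (subst (P (index l′)) (sym eq) (∈-satisfying⁻ (P? (index l′)) (enumerate-∈ (default∈ l′) y))))
  }
  where
  open ≤-Reasoning
  members : Fin t → List (Fin n)
  members i = satisfying (P? i)
  small? : Decidable λ i → length (members i) ≤ k
  small? i = length (members i) ≤? k
  small large : List (Fin t)
  small = filter small? I
  large = filter (¬? ∘ small?) I

  members-disjoint : ∀ {i j} → i ≢ j → ∀ {x} → x ∈ members i × x ∈ members j → ⊥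
  members-disjoint {i} {j} i≢j (p , q) = i≢j (disj (∈-satisfying⁻ (P? i) p) (∈-satisfying⁻ (P? j) q))

  -- The large sets are disjoint subsets of `Fin n` with at least `suc k` elements each.
  large-bound : length large * suc k ≤ k * L
  large-bound = begin
    length large * suc k              ≤⟨ length-concatMap-≥ (suc k) large (λ i∈ → ≰⇒> (proj₂ (∈-filter⁻ (¬? ∘ small?) {xs = I} i∈))) ⟩
    length (concatMap members large)  ≤⟨ unique-⊆⇒length≤ {ys = allFin n} (concat⁺
        (All-map⁺ (All.tabulate λ {i} _ → satisfying-unique (P? i)))
        (AllPairs-map⁺ (AllPairs.map members-disjoint (filter⁺ (¬? ∘ small?) uniq)))) (λ _ → ∈-allFin _) ⟩
    length (allFin n)                 ≡⟨ length-allFin n ⟩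
    n                                 ≤⟨ n≤kL ⟩
    k * L                             ∎

  large≤L : length large ≤ L
  large≤L = *-cancelʳ-≤ (length large) L (suc k) (begin
    length large * suc k  ≤⟨ large-bound ⟩
    k * L                 ≤⟨ m≤n+m (k * L) L ⟩
    suc k * L             ≡⟨ *-comm (suc k) L ⟩
    L * suc k             ∎)

  L≤small : L ≤ length small
  L≤small = +-cancelʳ-≤ L L (length small) (begin
    L + L                        ≤⟨ 2L≤I ⟩
    length I                     ≡⟨ length-filter-¬ small? I ⟨
    length small + length large  ≤⟨ +-monoʳ-≤ (length small) large≤L ⟩
    length small + L             ∎)

  index : Fin L → Fin t
  index l = lookup small (inject≤ l L≤small)

  index∈small : ∀ l → index l ∈ I × length (members (index l)) ≤ k
  index∈small l = ∈-filter⁻ small? {xs = I} (∈-lookup (inject≤ l L≤small))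

  index-injective : ∀ {l l′} → index l ≡ index l′ → l ≡ l′
  index-injective eq = inject≤-injective L≤small L≤small _ _ (lookup-injective (filter⁺ small? uniq) eq)

  default : Fin L → Fin n
  default l = proj₁ (nonempty (proj₁ (index∈small l)))

  default∈ : ∀ l → default l ∈ members (index l)
  default∈ l = ∈-satisfying⁺ (P? (index l)) (proj₂ (nonempty (proj₁ (index∈small l))))

-- C copies of a clique B glued to a clique A; F holds the non-edges between A and each copy of B.
module Glued (n C : ℕ) (F : Fin n → Fin n → Set) (F? : ∀ a b → Dec (F a b)) where

  Vertex : Set
  Vertex = Fin n ⊎ (Fin C × Fin n)

  order : ℕ
  order = n + C * n

  decode : Fin order → Vertex
  decode = map₂ (remQuot {C} n) ∘ splitAt n

  encode : Vertex → Fin order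
  encode = join n (C * n) ∘ map₂ (uncurry combine)

  decode-encode : ∀ w → decode (encode w) ≡ w
  decode-encode (inj₁ a)       = cong (map₂ (remQuot {C} n)) (splitAt-join n (C * n) (inj₁ a))
  decode-encode (inj₂ (c , b)) = trans (cong (map₂ (remQuot {C} n)) (splitAt-join n (C * n) (inj₂ (combine c b))))
    (cong inj₂ (remQuot-combine c b))

  encode-decode : ∀ x → encode (decode x) ≡ x
  encode-decode x = trans (cong (join n (C * n)) (map₂-inverse (splitAt n x))) (join-splitAt n (C * n) x)
    where
    map₂-inverse : ∀ w → map₂ (uncurry combine) (map₂ (remQuot {C} n) w) ≡ w
    map₂-inverse (inj₁ _) = refl
    map₂-inverse (inj₂ z) = cong inj₂ (combine-remQuot {C} n z)

  decode-injective : ∀ {x y} → decode x ≡ decode y → x ≡ y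
  decode-injective eq = trans (sym (encode-decode _)) (trans (cong encode eq) (encode-decode _))

  Edge : Vertex → Vertex → Set
  Edge (inj₁ a)       (inj₁ a′)        = a ≢ a′
  Edge (inj₁ a)       (inj₂ (_ , b))   = ¬ F a b
  Edge (inj₂ (_ , b)) (inj₁ a)         = ¬ F a b
  Edge (inj₂ (c , b)) (inj₂ (c′ , b′)) = c ≡ c′ × b ≢ b′

  edge-sym : ∀ v w → Edge v w → Edge w v
  edge-sym (inj₁ _)       (inj₁ _)       e           = e ∘ sym
  edge-sym (inj₁ _)       (inj₂ _)       e           = e
  edge-sym (inj₂ _)       (inj₁ _)       e           = e
  edge-sym (inj₂ _)       (inj₂ _)       (c≡ , b≢)   = sym c≡ , b≢ ∘ sym

  edge-irrefl : ∀ v → ¬ Edge v v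
  edge-irrefl (inj₁ _) e       = e refl
  edge-irrefl (inj₂ _) (_ , e) = e refl

  edge? : ∀ v w → Dec (Edge v w)
  edge? (inj₁ a)       (inj₁ a′)        = ¬? (a ≟ᶠ a′)
  edge? (inj₁ a)       (inj₂ (_ , b))   = ¬? (F? a b)
  edge? (inj₂ (_ , b)) (inj₁ a)         = ¬? (F? a b)
  edge? (inj₂ (c , b)) (inj₂ (c′ , b′)) = (c ≟ᶠ c′) ×-dec ¬? (b ≟ᶠ b′)

  graph : Graph order
  graph = record
    { Adj    = λ x y → Edge (decode x) (decode y)
    ; symm   = λ {x} {y} → edge-sym (decode x) (decode y)
    ; irrefl = λ { {x} refl → edge-irrefl (decode x) }
    ; adj?   = λ x y → edge? (decode x) (decode y)
    }

  module NoMinor {k L t : ℕ} (n≤kL : n ≤ k * L) (n+2L≤t : n + (L + L) ≤ t) (1≤L : 1 ≤ L)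
    (meets : (X Y : Fin L → Fin k → Fin n) → Separated X → Separated Y → ∃₂ λ i j → ∀ x y → F (X i x) (Y j y))
    {h} {H : Graph h} (sub : H IsSubgraphOf graph) (model : Model H (K t)) where

    open Model model
    open _IsSubgraphOf_ sub

    place : Fin h → Vertex
    place = decode ∘ embed

    place-injective : ∀ {x y} → place x ≡ place y → x ≡ y
    place-injective = injective ∘ decode-injective

    Occupies : Fin t → Vertex → Set
    Occupies i v = ∃ λ x → branch x ≡ i × place x ≡ v

    occupies-unique : ∀ {i j v} → Occupies i v → Occupies j v → i ≡ j
    occupies-unique (x , x∈i , px) (y , y∈j , py) with refl ← place-injective (trans px (sym py)) = trans (sym x∈i) y∈j

    _≟ᵛ_ : (v w : Vertex) → Dec (v ≡ w)
    v ≟ᵛ w = map′ (λ eq → trans (sym (decode-encode v)) (trans (cong decode eq) (decode-encode w))) (cong encode)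
      (encode v ≟ᶠ encode w)

    occupies? : ∀ i v → Dec (Occupies i v)
    occupies? i v = any? λ x → (branch x ≟ᶠ i) ×-dec (place x ≟ᵛ v)

    MeetsSide : (Fin n → Vertex) → Fin t → Set
    MeetsSide side i = ∃ λ a → Occupies i (side a)

    meetsSide? : ∀ side → Decidable (MeetsSide side)
    meetsSide? side i = any? λ a → occupies? i (side a)

    avoiding : (Fin n → Vertex) → List (Fin t)
    avoiding side = satisfying (¬? ∘ meetsSide? side)

    ∈-avoiding : ∀ side {i} → i ∈ avoiding side → ¬ MeetsSide side i
    ∈-avoiding side = ∈-satisfying⁻ (¬? ∘ meetsSide? side)

    -- Branch sets meeting a side inject into it.
    many-avoiding : ∀ side → L + L ≤ length (avoiding side)
    many-avoiding side = +-cancelˡ-≤ n (L + L) (length (avoiding side)) (begin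
      n + (L + L)                                             ≤⟨ n+2L≤t ⟩
      t                                                       ≡⟨ length-allFin t ⟨
      length (allFin t)                                       ≡⟨ length-filter-¬ (meetsSide? side) (allFin t) ⟨
      count (meetsSide? side) + length (avoiding side)        ≤⟨ +-monoˡ-≤ (length (avoiding side)) few ⟩
      n + length (avoiding side)                              ∎)
      where
      open ≤-Reasoning
      few : count (meetsSide? side) ≤ n
      few = subst (count (meetsSide? side) ≤_) (length-allFin n)
        (matching⇒length≤ (λ i a → Occupies i (side a)) (satisfying-unique (meetsSide? side))
          (λ i∈ → let a , occ = ∈-satisfying⁻ (meetsSide? side) i∈ in a , ∈-allFin a , occ) occupies-unique)

    missingA : List (Fin t)
    missingA = avoiding inj₁

    InCopy : Fin C → Vertex → Set
    InCopy c v = ∃ λ b → v ≡ inj₂ (c , b)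

    edge-in-copy : ∀ {c v w} → InCopy c v → Edge v w → (∃ λ a → w ≡ inj₁ a) ⊎ InCopy c w
    edge-in-copy {w = inj₁ a}       _          _          = inj₁ (a , refl)
    edge-in-copy {w = inj₂ (_ , b)} (_ , refl) (refl , _) = inj₂ (b , refl)

    -- An edge leaves a copy of B only towards A, and a branch set in `missingA` has no vertex
    -- there.
    step-in-copy : ∀ {i c x y} → i ∈ missingA → branch y ≡ i → InCopy c (place x) → Graph.Adj H x y → InCopy c (place y)
    step-in-copy i∈ y∈i copy e with edge-in-copy copy (preserves e)
    ... | inj₁ (a , eq) = ⊥-elim (∈-avoiding inj₁ i∈ (a , _ , y∈i , eq))
    ... | inj₂ copy′    = copy′

    stays-in-copy : ∀ {i c x y} → i ∈ missingA → branch x ≡ i → InCopy c (place x) →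
      Star (λ u v → Graph.Adj H u v × branch u ≡ branch v) x y → InCopy c (place y)
    stays-in-copy i∈ x∈i copy Star.ε = copy
    stays-in-copy i∈ x∈i copy ((e , same) ◅ path) =
      let z∈i = trans (sym same) x∈i in stays-in-copy i∈ z∈i (step-in-copy i∈ z∈i copy e) path

    module Home {i₀ start c₀} (i₀∈ : i₀ ∈ missingA) (start∈ : branch start ≡ i₀) (home : InCopy c₀ (place start)) where

      copy : Fin n → Vertex
      copy b = inj₂ (c₀ , b)

      -- Branch sets missing A are pairwise adjacent, so they all lie in one copy of B.
      in-home : ∀ {i x} → i ∈ missingA → branch x ≡ i → InCopy c₀ (place x)
      in-home {i} {x} i∈ x∈i with i ≟ᶠ i₀
      ... | yes refl = stays-in-copy i∈ start∈ home (connected (trans start∈ (sym x∈i)))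
      ... | no i≢ with touching i≢
      ...   | y , z , y∈i , z∈ , e = stays-in-copy i∈ y∈i
              (step-in-copy i∈ y∈i
                (stays-in-copy (i₀∈) start∈ home (connected (trans start∈ (sym z∈))))
                (Graph.symm H e))
              (connected (trans y∈i (sym x∈i)))

      -- X traces on A the branch sets missing the copy, Y traces on the copy those missing A.
      X-family : SmallFamily k L (λ i a → Occupies i (inj₁ a)) (avoiding copy)
      X-family = small-family k L _ (λ i a → occupies? i (inj₁ a)) occupies-unique (avoiding copy)
        (satisfying-unique (¬? ∘ meetsSide? copy)) meets-A (many-avoiding copy) n≤kL
        where
        meets-A : ∀ {i} → i ∈ avoiding copy → MeetsSide inj₁ i
        -- A branch set missing A would lie in the home copy, which the branch sets considered here
        -- avoid.
        meets-A {i} i∈ = decidable-stable (meetsSide? inj₁ i) λ ¬A →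
          let x , x∈i = nonempty i
              b , eq  = in-home (∈-satisfying⁺ (¬? ∘ meetsSide? inj₁) ¬A) x∈i
          in ∈-avoiding copy i∈ (b , x , x∈i , eq)

      Y-family : SmallFamily k L (λ i b → Occupies i (copy b)) missingA
      Y-family = small-family k L _ (λ i b → occupies? i (copy b)) occupies-unique missingA
        (satisfying-unique (¬? ∘ meetsSide? inj₁)) meets-copy (many-avoiding inj₁) n≤kL
        where
        meets-copy : ∀ {i} → i ∈ missingA → MeetsSide copy i
        meets-copy {i} i∈ = let x , x∈i = nonempty i
                                b , eq  = in-home i∈ x∈i
                            in b , x , x∈i , eq

      clash : SmallFamily k L (λ i a → Occupies i (inj₁ a)) (avoiding copy) →
        SmallFamily k L (λ i b → Occupies i (copy b)) missingA → ⊥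
      clash Xs Ys = no-edge (touching X≢Y)
        where
        module X = SmallFamily Xs
        module Y = SmallFamily Ys
        found : ∃₂ λ i j → ∀ x y → F (X.family i x) (Y.family j y)
        found = meets X.family Y.family X.separated Y.separated
        i j : Fin L
        i = proj₁ found
        j = proj₁ (proj₂ found)
        X≢Y : X.index i ≢ Y.index j
        X≢Y eq = let x , x∈ = nonempty (Y.index j)
                     b , p  = in-home (Y.index∈ j) x∈
                 in ∈-avoiding copy (X.index∈ i) (b , x , trans x∈ (sym eq) , p)
        -- An endpoint of the supposed edge that lies in A is a member of the chosen X-set, and the
        -- other endpoint of the chosen Y-set, so the pair is in `F`. An endpoint in a copy would
        -- have to be in the home copy, which its branch set avoids.
        no-edge′ : ∀ {x y v w} → place x ≡ v → place y ≡ w → branch x ≡ X.index i → branch y ≡ Y.index j →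
          InCopy c₀ w → Edge v w → ⊥
        no-edge′ {v = inj₁ a} px py x∈ y∈ (b , refl) e =
          let u , u≡a = X.covers i (_ , x∈ , px)
              v , v≡b = Y.covers j (_ , y∈ , py)
          in e (subst₂ F u≡a v≡b (proj₂ (proj₂ found) u v))
        no-edge′ {v = inj₂ (_ , b′)} px py x∈ y∈ (b , refl) (refl , _) =
          ∈-avoiding copy (X.index∈ i) (b′ , _ , x∈ , px)
        no-edge : (∃₂ λ x y → branch x ≡ X.index i × branch y ≡ Y.index j × Graph.Adj H x y) → ⊥
        no-edge (x , y , x∈ , y∈ , e) = no-edge′ refl refl x∈ y∈ (in-home (Y.index∈ j) y∈) (preserves e)

    impossible : ⊥
    -- As `L` is positive, some branch set misses A; the copy of B containing one of its vertices
    -- serves as the home copy.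
    impossible = let i₀ , i₀∈ = first (≤-trans (≤-trans 1≤L (m≤m+n L L)) (many-avoiding inj₁))
                     start , start∈ = nonempty i₀
                     c₀ , home = find i₀∈ start∈ (place start) refl
                 in Home.clash i₀∈ start∈ home (Home.X-family i₀∈ start∈ home) (Home.Y-family i₀∈ start∈ home)
      where
      first : ∀ {xs} → 1 ≤ length xs → ∃ λ (i : Fin t) → i ∈ xs
      first {x ∷ _} _ = x , here refl
      find : ∀ {i x} → i ∈ missingA → branch x ≡ i → ∀ v → place x ≡ v → ∃ λ c → InCopy c v
      find i∈ x∈i (inj₁ a)       eq = ⊥-elim (∈-avoiding inj₁ i∈ (a , _ , x∈i , eq))
      find i∈ x∈i (inj₂ (c , b)) eq = c , b , refl

  no-minor : ∀ {k L t} → n ≤ k * L → n + (L + L) ≤ t → 1 ≤ L →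
    ((X Y : Fin L → Fin k → Fin n) → Separated X → Separated Y → ∃₂ λ i j → ∀ x y → F (X i x) (Y j y)) →
    ¬ (K t IsMinorOf graph)
  no-minor n≤kL n+2L≤t 1≤L meets (_ , _ , _ , sub , contr , iso) =
    NoMinor.impossible n≤kL n+2L≤t 1≤L meets sub (model-≅ iso (contracts⇒model contr))

-- List colourings

take-⊆ : ∀ {A : Set} a (xs : List A) → take a xs ⊆ xs
take-⊆ a xs x∈ = subst (_ ∈_) (take++drop≡id a xs) (∈-++⁺ˡ x∈)

truncate : ∀ a (xs : List ℕ) → Unique xs → a ≤ length xs → ColourSet a
truncate a xs uniq a≤xs = record
  { colours = take a xs
  ; unique  = take⁺ a uniq
  ; size    = trans (length-take a xs) (m≤n⇒m⊓n≡m a≤xs)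
  }

nth : ∀ {m} → ColourSet m → Fin m → ℕ
nth S i = lookup (colours S) (cast (sym (ColourSet.size S)) i)

nth-∈ : ∀ {m} (S : ColourSet m) i → nth S i ∈ colours S
nth-∈ S i = ∈-lookup (cast (sym (ColourSet.size S)) i)

nth-surjective : ∀ {m} (S : ColourSet m) {x} → x ∈ colours S → ∃ λ i → nth S i ≡ x
nth-surjective S x∈ = cast size (Any.index x∈) ,
  trans (cong (lookup (colours S)) (cast-involutive (sym size) size (Any.index x∈))) (sym (lookup-index x∈))
  where open ColourSet S using (size)

-- There is one copy of B for each tuple of m-tuples of colours < P on A; in that copy the list of b
-- omits the colours which the tuple puts on the non-neighbours of b.
module ListColouring (n m a d P : ℕ) (F : Fin n → Fin n → Set) (F? : ∀ a b → Dec (F a b))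
  (degree : ∀ b → count (λ a → F? a b) ≤ d) (a+dm≤P : a + d * m ≤ P) (P<2nm : P < (n + n) * m) where

  copies : ℕ
  copies = (P ^ m) ^ n

  open Glued n copies F F?

  tupleColours : Fin copies → Fin n → List ℕ
  tupleColours c x = tabulate (toℕ ∘ finToFun {P} {m} (finToFun {P ^ m} {n} c x))

  forbidden : Fin copies → Fin n → List ℕ
  forbidden c b = concatMap (tupleColours c) (satisfying λ x → F? x b)

  candidates : Vertex → List ℕ
  candidates (inj₁ _)       = upTo P
  candidates (inj₂ (c , b)) = filter (λ z → ¬? (z ∈? forbidden c b)) (upTo P)

  candidates-unique : ∀ v → Unique (candidates v)
  candidates-unique (inj₁ _)       = upTo⁺ P
  candidates-unique (inj₂ (c , b)) = filter⁺ (λ z → ¬? (z ∈? forbidden c b)) (upTo⁺ P)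

  candidates-<P : ∀ v {z} → z ∈ candidates v → z < P
  candidates-<P (inj₁ _)       z∈ = ∈-upTo⁻ z∈
  candidates-<P (inj₂ (c , b)) z∈ = ∈-upTo⁻ (proj₁ (∈-filter⁻ (λ z → ¬? (z ∈? forbidden c b)) {xs = upTo P} z∈))

  length-forbidden : ∀ c b → length (forbidden c b) ≤ d * m
  length-forbidden c b = begin
    length (forbidden c b)       ≡⟨ *-identityˡ _ ⟨
    1 * length (forbidden c b)   ≤⟨ length-concatMap-≤ 1 m (λ x → ≤-reflexive (trans (*-identityˡ _) (length-tabulate {n = m} _))) (satisfying λ x → F? x b) ⟩
    count (λ x → F? x b) * m     ≤⟨ *-monoˡ-≤ m (degree b) ⟩
    d * m                        ∎
    where open ≤-Reasoning

  -- At most `d` non-neighbours with `m` colours each are forbidden to a vertex of a copy, which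
  -- leaves at least `P` minus `d * m` colours.
  enough : ∀ v → a ≤ length (candidates v)
  enough (inj₁ _)       = subst (a ≤_) (sym (length-upTo P)) (≤-trans (m≤m+n a (d * m)) a+dm≤P)
  enough (inj₂ (c , b)) = +-cancelʳ-≤ (d * m) a (length (candidates (inj₂ (c , b)))) (begin
    a + d * m                              ≤⟨ a+dm≤P ⟩
    P                                      ≡⟨ length-upTo P ⟨
    length (upTo P)                        ≡⟨ length-filter-¬ (_∈? forbidden c b) (upTo P) ⟨
    length lost + length kept              ≤⟨ +-monoˡ-≤ (length kept) (≤-trans
      (unique-⊆⇒length≤ (filter⁺ (_∈? forbidden c b) (upTo⁺ P)) (λ z∈ → proj₂ (∈-filter⁻ (_∈? forbidden c b) {xs = upTo P} z∈)))
      (length-forbidden c b)) ⟩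
    d * m + length kept                    ≡⟨ +-comm (d * m) _ ⟩
    length kept + d * m                    ∎)
    where
    open ≤-Reasoning
    lost kept : List ℕ
    lost = filter (_∈? forbidden c b) (upTo P)
    kept = candidates (inj₂ (c , b))

  -- Lists must have exactly `a` colours. Which candidates survive the truncation is irrelevant, as
  -- the argument relies only on the lists being contained in `candidates`.
  lists : ListAssignment graph a
  lists x = truncate a (candidates (decode x)) (candidates-unique (decode x)) (enough (decode x))

  module _ (colouring : FoldLColouring graph lists m) where

    φ : Vertex → ColourSet m
    φ v = FoldColouring.φ (proj₁ colouring) (encode v)

    φ-⊆ : ∀ v → colours (φ v) ⊆ candidates v
    φ-⊆ v z∈ = subst (λ w → _ ∈ candidates w) (decode-encode v) (take-⊆ a _ (proj₂ colouring (encode v) z∈))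

    φ-proper : ∀ v w → Edge v w → Disjoint (colours (φ v)) (colours (φ w))
    φ-proper v w e = FoldColouring.proper (proj₁ colouring)
      (subst₂ Edge (sym (decode-encode v)) (sym (decode-encode w)) e)

    onA : Fin n → Fin m → Fin P
    onA x i = fromℕ< (candidates-<P (inj₁ x) (φ-⊆ (inj₁ x) (nth-∈ (φ (inj₁ x)) i)))

    -- The copy indexed by the tuple that the given colouring puts on A.
    c₀ : Fin copies
    c₀ = funToFin (funToFin ∘ onA)

    ∈-tupleColours : ∀ x {z} → z ∈ colours (φ (inj₁ x)) → z ∈ tupleColours c₀ x
    ∈-tupleColours x z∈ with nth-surjective (φ (inj₁ x)) z∈
    ... | i , refl = subst (_∈ tupleColours c₀ x) value (∈-tabulate⁺ i)
      where
      value : toℕ (finToFun {P} {m} (finToFun {P ^ m} {n} c₀ x) i) ≡ nth (φ (inj₁ x)) i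
      value = trans (cong toℕ (trans (cong (λ z → finToFun {P} {m} z i) (finToFun-funToFin (funToFin ∘ onA) x))
        (finToFun-funToFin (onA x) i))) (toℕ-fromℕ< _)

    -- Neighbours have disjoint sets by properness; for a non-neighbour `x` of `b`, the colours of
    -- `x` were removed from the candidates of `b` in this copy.
    A-B-disjoint : ∀ x b → Disjoint (colours (φ (inj₁ x))) (colours (φ (inj₂ (c₀ , b))))
    A-B-disjoint x b with F? x b
    ... | no ¬Fxb = φ-proper (inj₁ x) (inj₂ (c₀ , b)) ¬Fxb
    ... | yes Fxb = λ (z∈x , z∈b) →
      proj₂ (∈-filter⁻ (λ z → ¬? (z ∈? forbidden c₀ b)) {xs = upTo P} (φ-⊆ (inj₂ (c₀ , b)) z∈b))
        (∈-concatMap⁺ (tupleColours c₀)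
          (Any.map (λ { refl → ∈-tupleColours x z∈x }) (∈-satisfying⁺ (λ x → F? x b) Fxb)))

    vertices : List Vertex
    vertices = map inj₁ (allFin n) ++ map (λ b → inj₂ (c₀ , b)) (allFin n)

    vertices-disjoint : AllPairs (λ v w → Disjoint (colours (φ v)) (colours (φ w))) vertices
    vertices-disjoint = AllPairs-++⁺
      (AllPairs-map⁺ (AllPairs.map (λ x≢y {z} → φ-proper (inj₁ _) (inj₁ _) x≢y {z}) (allFin⁺ n)))
      (AllPairs-map⁺ (AllPairs.map (λ x≢y {z} → φ-proper (inj₂ (c₀ , _)) (inj₂ (c₀ , _)) (refl , x≢y) {z}) (allFin⁺ n)))
      (All-map⁺ (All.tabulate λ {x} _ → All-map⁺ (All.tabulate λ {b} _ {z} → A-B-disjoint x b {z})))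

    length-vertices : length vertices ≡ n + n
    length-vertices = trans (length-++ (map inj₁ (allFin n))) (cong₂ _+_
      (trans (length-map inj₁ (allFin n)) (length-allFin n))
      (trans (length-map _ (allFin n)) (length-allFin n)))

    used : List ℕ
    used = concatMap (colours ∘ φ) vertices

    used-unique : Unique used
    used-unique = concat⁺ (All-map⁺ (All.tabulate λ {v} _ → ColourSet.unique (φ v))) (AllPairs-map⁺ vertices-disjoint)

    used-⊆ : used ⊆ upTo P
    used-⊆ {z} z∈ with Any.satisfied (∈-concatMap⁻ (colours ∘ φ) {xs = vertices} z∈)
    ... | v , z∈v = ∈-upTo⁺ (candidates-<P v (φ-⊆ v z∈v))

    -- The `n + n` vertices of A and of copy `c₀` carry pairwise disjoint sets of `m` colours below
    -- `P`.
    too-many-colours : ⊥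
    too-many-colours = <-irrefl refl (begin-strict
      P                    <⟨ P<2nm ⟩
      (n + n) * m          ≡⟨ cong (_* m) length-vertices ⟨
      length vertices * m  ≤⟨ length-concatMap-≥ m vertices (λ {v} _ → ≤-reflexive (sym (ColourSet.size (φ v)))) ⟩
      length used          ≤⟨ unique-⊆⇒length≤ used-unique used-⊆ ⟩
      length (upTo P)      ≡⟨ length-upTo P ⟩
      P                    ∎)
      where open ≤-Reasoning

  not-choosable : ¬ Choosable graph a m
  not-choosable choose = too-many-colours (choose lists)

-- Real bounds

ι : ℕ → ℚᵘ
ι n = mkℚᵘ (ℤ.+ n) 0

toℚᵘ-fromℕ : ∀ n → toℚᵘ (fromℕ n) ℚᵘ.≃ ι n
toℚᵘ-fromℕ n = ℚₚ.toℚᵘ-fromℚᵘ (ι n)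

fromℕ-+ : ∀ m n → fromℕ m ℚ.+ fromℕ n ≡ fromℕ (m + n)
fromℕ-+ m n = ℚₚ.toℚᵘ-injective (begin
  toℚᵘ (fromℕ m ℚ.+ fromℕ n)              ≈⟨ ℚₚ.toℚᵘ-homo-+ (fromℕ m) (fromℕ n) ⟩
  toℚᵘ (fromℕ m) ℚᵘ.+ toℚᵘ (fromℕ n)    ≈⟨ ℚᵘₚ.+-cong (toℚᵘ-fromℕ m) (toℚᵘ-fromℕ n) ⟩
  ι m ℚᵘ.+ ι n                          ≈⟨ *≡* (cong (ℤ._* ℤ.+ 1) (cong₂ ℤ._+_ (ℤₚ.*-identityʳ (ℤ.+ m)) (ℤₚ.*-identityʳ (ℤ.+ n)))) ⟩
  ι (m + n)                           ≈⟨ toℚᵘ-fromℕ (m + n) ⟨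
  toℚᵘ (fromℕ (m + n))                ∎)
  where open ℚᵘₚ.≃-Reasoning

fromℕ-* : ∀ m n → fromℕ m ℚ.* fromℕ n ≡ fromℕ (m * n)
fromℕ-* m n = ℚₚ.toℚᵘ-injective (begin
  toℚᵘ (fromℕ m ℚ.* fromℕ n)              ≈⟨ ℚₚ.toℚᵘ-homo-* (fromℕ m) (fromℕ n) ⟩
  toℚᵘ (fromℕ m) ℚᵘ.* toℚᵘ (fromℕ n)    ≈⟨ ℚᵘₚ.*-cong (toℚᵘ-fromℕ m) (toℚᵘ-fromℕ n) ⟩
  ι m ℚᵘ.* ι n                          ≈⟨ *≡* (cong (ℤ._* ℤ.+ 1) (sym (ℤₚ.pos-* m n))) ⟩
  ι (m * n)                           ≈⟨ toℚᵘ-fromℕ (m * n) ⟨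
  toℚᵘ (fromℕ (m * n))                ∎)
  where open ℚᵘₚ.≃-Reasoning

fromℕ-cancel-< : ∀ {m n} → fromℕ m ℚ.< fromℕ n → m < n
fromℕ-cancel-< {m} {n} m<n = ℤₚ.drop‿+<+ (subst₂ ℤ._<_ (ℤₚ.*-identityʳ (ℤ.+ m)) (ℤₚ.*-identityʳ (ℤ.+ n)) (ℚᵘₚ.drop-*<*
  (ℚᵘₚ.<-respʳ-≃ (toℚᵘ-fromℕ n) (ℚᵘₚ.<-respˡ-≃ (toℚᵘ-fromℕ m) (ℚₚ.toℚᵘ-mono-< m<n)))))

-- Writes a positive rational as `suc N` over `suc D`, hence bounds it below by 1 over `suc D`.
clear-denominator : ∀ q → 0ℚ ℚ.< q → ∃₂ λ N D → q ℚ.* fromℕ (suc D) ≡ fromℕ (suc N)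
clear-denominator (mkℚ ℤ.+0 d c)       (*<* (ℤ.+<+ ()))
clear-denominator (mkℚ ℤ.-[1+ n ] d c) (*<* ())
clear-denominator q@(mkℚ ℤ.+[1+ n ] d c) _ = n , d , ℚₚ.toℚᵘ-injective (begin
  toℚᵘ (q ℚ.* fromℕ (suc d))             ≈⟨ ℚₚ.toℚᵘ-homo-* q (fromℕ (suc d)) ⟩
  toℚᵘ q ℚᵘ.* toℚᵘ (fromℕ (suc d))     ≈⟨ ℚᵘₚ.*-congˡ {toℚᵘ q} (toℚᵘ-fromℕ (suc d)) ⟩
  toℚᵘ q ℚᵘ.* ι (suc d)                ≈⟨ *≡* (trans (ℤₚ.*-identityʳ _) (cong (λ z → ℤ.+ suc n ℤ.* ℤ.+ suc z) (sym (*-identityʳ d)))) ⟩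
  ι (suc n)                            ≈⟨ toℚᵘ-fromℕ (suc n) ⟨
  toℚᵘ (fromℕ (suc n))                 ∎)
  where open ℚᵘₚ.≃-Reasoning

lower<upper : ∀ (x : ℝ) {p q} → p <ˡ x → x <ᵘ q → p ℚ.< q
lower<upper x {p} {q} p<x x<q with p ℚₚ.<? q | q ℚₚ.<? p
... | yes p<q | _       = p<q
... | no  _   | yes q<p = ⊥-elim (ℝ.disjoint x p<x (ℝ.upper-closed x q<p x<q))
... | no  p≮q | no  q≮p = ⊥-elim (ℝ.disjoint x p<x (subst (ℝ.upper x) (ℚₚ.≤-antisym (ℚₚ.≮⇒≥ p≮q) (ℚₚ.≮⇒≥ q≮p)) x<q))

-- a < (2 − ε) T + 1 and 1 / (1 + p) ≤ ε, multiplied by 1 + p and with the subtraction moved across.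
rounding-bound : ∀ (ε : ℝ) → 0ℚ <ˡ ε → ∃ λ p → ∀ a T → IsRoundingOf a ((fromℕ 2 − ε) · T) →
  a * suc p + T < (2 * T + 1) * suc p
rounding-bound ε 0<ε with ℝ.lower-open ε 0<ε
... | q , 0<q , q<ε with clear-denominator q 0<q
-- Membership in the lower cut of the product supplies `r` with ε < 2 - r and a - 1 < rT. Together
-- with q < ε this bounds `r` by 2 - q.
...   | N , D , qD≡N = D , λ a T ((r , ε<2-r , a-1<rT) , _) →
  -- The numerator `suc N` is weakened to 1, so that `D` alone describes the bound on ε.
  ≤-<-trans (+-monoʳ-≤ (a * suc D) (m≤m+n T (N * T)))
    (fromℕ-cancel-< (bound a T r (lower<upper ε q<ε ε<2-r) a-1<rT))
  where
  open ℚₚ.≤-Reasoning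
  open +-*-Solver
  δ : ℚ
  δ = fromℕ (suc D)
  bound : ∀ a T r → q ℚ.< fromℕ 2 ℚ.- r → fromℕ a ℚ.- 1ℚ ℚ.< r ℚ.* fromℕ T →
    fromℕ (a * suc D + suc N * T) ℚ.< fromℕ ((2 * T + 1) * suc D)
  bound a T r q<2-r a-1<rT = begin-strict
    fromℕ (a * suc D + suc N * T)                ≡⟨ fromℕ-+ (a * suc D) (suc N * T) ⟨
    fromℕ (a * suc D) ℚ.+ fromℕ (suc N * T)          ≡⟨ cong₂ ℚ._+_ (fromℕ-* a (suc D)) (fromℕ-* (suc N) T) ⟨
    α ℚ.* δ ℚ.+ fromℕ (suc N) ℚ.* τ                          ≡⟨ cong (λ z → α ℚ.* δ ℚ.+ z ℚ.* τ) qD≡N ⟨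
    α ℚ.* δ ℚ.+ q ℚ.* δ ℚ.* τ                                  ≡⟨ solve 4 (λ α δ q τ → α :* δ :+ q :* δ :* τ := ((α :- con 1ℚ) :+ (q :* τ :+ con 1ℚ)) :* δ) refl α δ q τ ⟩
    ((α ℚ.- 1ℚ) ℚ.+ (q ℚ.* τ ℚ.+ 1ℚ)) ℚ.* δ                      <⟨ ℚₚ.*-monoˡ-<-pos δ {{ℚₚ.normalize-pos (suc D) 1}} (ℚₚ.+-monoˡ-< (q ℚ.* τ ℚ.+ 1ℚ) a-1<rT) ⟩
    (r ℚ.* τ ℚ.+ (q ℚ.* τ ℚ.+ 1ℚ)) ℚ.* δ                         ≤⟨ ℚₚ.*-monoʳ-≤-nonNeg δ {{ℚₚ.normalize-nonNeg (suc D) 1}} (ℚₚ.+-monoʳ-≤ (r ℚ.* τ)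
                                                            (ℚₚ.+-monoˡ-≤ 1ℚ (ℚₚ.*-monoʳ-≤-nonNeg τ {{ℚₚ.normalize-nonNeg T 1}} (ℚₚ.<⇒≤ q<2-r)))) ⟩
    (r ℚ.* τ ℚ.+ ((fromℕ 2 ℚ.- r) ℚ.* τ ℚ.+ 1ℚ)) ℚ.* δ             ≡⟨ solve 4 (λ t r τ δ → (r :* τ :+ ((t :- r) :* τ :+ con 1ℚ)) :* δ := (t :* τ :+ con 1ℚ) :* δ) refl (fromℕ 2) r τ δ ⟩
    (fromℕ 2 ℚ.* τ ℚ.+ 1ℚ) ℚ.* δ                             ≡⟨ cong (λ z → (z ℚ.+ 1ℚ) ℚ.* δ) (fromℕ-* 2 T) ⟩
    (fromℕ (2 * T) ℚ.+ fromℕ 1) ℚ.* δ                    ≡⟨ cong (ℚ._* δ) (fromℕ-+ (2 * T) 1) ⟩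
    fromℕ (2 * T + 1) ℚ.* δ                          ≡⟨ fromℕ-* (2 * T + 1) (suc D) ⟩
    fromℕ ((2 * T + 1) * suc D)                  ∎
    where
    α τ : ℚ
    α = fromℕ a
    τ = fromℕ T

-- Choice of parameters

-- Pigeonhole: if each of the `r` colour classes had more than `d` elements, there would be more
-- than `n` elements in all.
rare-colour : ∀ {n r d} (g : Fin n → Fin r) → n < r * suc d → ∃ λ c → count (λ a → g a ≟ᶠ c) ≤ d
rare-colour {n} {r} {d} g n<r[1+d] with any? (λ c → count (λ a → g a ≟ᶠ c) ≤? d)
... | yes found = found
... | no  none  = ⊥-elim (<-irrefl refl (begin-strict
    n                                       <⟨ n<r[1+d] ⟩
    r * suc d                               ≡⟨ cong (_* suc d) (length-allFin r) ⟨
    length (allFin r) * suc d               ≤⟨ length-concatMap-≥ (suc d) (allFin r) (λ {c} _ → ≰⇒> λ ≤d → none (c , ≤d)) ⟩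
    length (concatMap classOf (allFin r))   ≤⟨ unique-⊆⇒length≤ {ys = allFin n} (concat⁺
      (All-map⁺ (All.tabulate λ {c} _ → satisfying-unique (λ a → g a ≟ᶠ c)))
      (AllPairs-map⁺ (AllPairs.map (λ c≢c′ {x} (p , q) → c≢c′ (trans
        (sym (∈-satisfying⁻ (λ a → g a ≟ᶠ _) p)) (∈-satisfying⁻ (λ a → g a ≟ᶠ _) q))) (allFin⁺ r))))
      (λ _ → ∈-allFin _) ⟩
    length (allFin n)                       ≡⟨ length-allFin n ⟩
    n                                       ∎))
  where
  open ≤-Reasoning
  classOf : Fin r → List (Fin n)
  classOf c = satisfying (λ a → g a ≟ᶠ c)

^-distribʳ-* : ∀ n a b → (a * b) ^ n ≡ a ^ n * b ^ n
^-distribʳ-* zero    a b = refl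
^-distribʳ-* (suc n) a b = trans (cong (a * b *_) (^-distribʳ-* n a b)) (interchange a b (a ^ n) (b ^ n))
  where
  interchange : ∀ a b x y → a * b * (x * y) ≡ a * x * (b * y)
  interchange = solve-∀

n<2^n : ∀ n → n < 2 ^ n
n<2^n zero    = s≤s z≤n
n<2^n (suc n) = begin-strict
  suc n              ≤⟨ n<2^n n ⟩
  2 ^ n              <⟨ m<m+n (2 ^ n) (m^n>0 2 n) ⟩
  2 ^ n + 2 ^ n      ≡⟨ cong (2 ^ n +_) (+-identityʳ (2 ^ n)) ⟨
  2 ^ suc n          ∎
  where open ≤-Reasoning

-- Induction on the exponent by halving `w` to `v`: since `w` is at most `3 * v`, one factor `v` is
-- below `2 ^ v`, and the induction hypothesis with the enlarged constant `C * 3 ^ suc e` bounds the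
-- rest by another `2 ^ v`.
polynomial<exponential : ∀ e C → ∃ λ w₀ → ∀ w → w₀ ≤ w → C * w ^ e < 2 ^ w
polynomial<exponential zero C = C , λ w C≤w → begin-strict
  C * 1  ≡⟨ *-identityʳ C ⟩
  C      ≤⟨ C≤w ⟩
  w      <⟨ n<2^n w ⟩
  2 ^ w  ∎
  where open ≤-Reasoning
polynomial<exponential (suc e) C with polynomial<exponential e (C * 3 ^ suc e)
... | v₀ , bound = suc v₀ + suc v₀ , λ w large → let v = ⌊ w /2⌋ in grow w v
    (≤-trans (≤-reflexive (n≡⌊n+n/2⌋ (suc v₀))) (⌊n/2⌋-mono large))
    (≤-trans (+-monoʳ-≤ v (⌊n/2⌋≤⌈n/2⌉ w)) (≤-reflexive (⌊n/2⌋+⌈n/2⌉≡n w)))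
    (≤-trans (≤-reflexive (sym (⌊n/2⌋+⌈n/2⌉≡n w))) (+-monoʳ-≤ v (⌊n/2⌋-mono (n≤1+n (suc w)))))
  where
  open ≤-Reasoning
  regroup : ∀ C T X v → C * (T * (v * X)) ≡ C * T * X * v
  regroup = solve-∀
  grow : ∀ w v → suc v₀ ≤ v → v + v ≤ w → w ≤ v + suc v → C * w ^ suc e < 2 ^ w
  grow w v v₀<v 2v≤w w≤2v+1 = begin-strict
    C * w ^ suc e                  ≤⟨ *-monoʳ-≤ C (^-monoˡ-≤ (suc e) w≤3v) ⟩
    C * (3 * v) ^ suc e            ≡⟨ cong (C *_) (^-distribʳ-* (suc e) 3 v) ⟩
    C * (3 ^ suc e * v ^ suc e)    ≡⟨ regroup C (3 ^ suc e) (v ^ e) v ⟩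
    C * 3 ^ suc e * v ^ e * v      <⟨ *-mono-< (bound v (≤-trans (n≤1+n v₀) v₀<v)) (n<2^n v) ⟩
    2 ^ v * 2 ^ v                  ≡⟨ ^-distribˡ-+-* 2 v v ⟨
    2 ^ (v + v)                    ≤⟨ ^-monoʳ-≤ 2 2v≤w ⟩
    2 ^ w                          ∎
    where
    w≤3v : w ≤ 3 * v
    w≤3v = begin
      w                  ≤⟨ w≤2v+1 ⟩
      v + (1 + v)        ≤⟨ +-monoʳ-≤ v (+-monoˡ-≤ v (≤-trans (s≤s z≤n) v₀<v)) ⟩
      v + (v + v)        ≡⟨ cong (λ z → v + (v + z)) (+-identityʳ v) ⟨
      3 * v              ∎

-- The left side consists of the first two terms of the binomial expansion.
bernoulli : ∀ x j → x ^ suc j + suc j * x ^ j ≤ suc x ^ suc j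
bernoulli x zero    = ≤-reflexive (base x)
  where
  base : ∀ x → x * 1 + (1 + 0) ≡ (1 + x) * 1
  base = solve-∀
bernoulli x (suc j) = begin
  x ^ suc (suc j) + suc (suc j) * x ^ suc j                    ≤⟨ m≤m+n _ (suc j * x ^ j) ⟩
  x ^ suc (suc j) + suc (suc j) * x ^ suc j + suc j * x ^ j    ≡⟨ expand x j (x ^ j) ⟩
  suc x * (x ^ suc j + suc j * x ^ j)                          ≤⟨ *-monoʳ-≤ (suc x) (bernoulli x j) ⟩
  suc x ^ suc (suc j)                                          ∎
  where
  open ≤-Reasoning
  expand : ∀ x j X → x * (x * X) + (2 + j) * (x * X) + (1 + j) * X ≡ (1 + x) * (x * X + (1 + j) * X)
  expand = solve-∀

-- For positive `q` this is (1 + 1/q)^(1+q) ≥ 2, cleared of fractions.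
2*q^[1+q]≤[1+q]^[1+q] : ∀ q → 2 * q ^ suc q ≤ suc q ^ suc q
2*q^[1+q]≤[1+q]^[1+q] q = begin
  q ^ suc q + (q ^ suc q + 0)       ≡⟨ cong (q ^ suc q +_) (+-identityʳ _) ⟩
  q ^ suc q + q * q ^ q             ≤⟨ +-monoʳ-≤ (q ^ suc q) (*-monoˡ-≤ (q ^ q) (n≤1+n q)) ⟩
  q ^ suc q + suc q * q ^ q         ≤⟨ bernoulli q q ⟩
  suc q ^ suc q                     ∎
  where open ≤-Reasoning

-- As `n ≡ k * L`, the number of events is an `L`-th power with base `n ^ k * n ^ k * r ^ k`. As `L`
-- is `w` multiples of `suc q`, the ratio (1 + 1/q)^(L²) is at least `2 ^ w` to the power `L`. It
-- remains to compare the bases.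
few-events : ∀ n k L r q w → L ≡ suc q * w → n ≡ k * L → 1 ≤ q → 1 ≤ L → n ^ k * n ^ k * r ^ k < 2 ^ w →
  (n ^ k) ^ L * (n ^ k) ^ L * r ^ n * q ^ (L * L) < suc q ^ (L * L)
few-events n k L r q w L≡ n≡kL 1≤q 1≤L small = begin-strict
  (n ^ k) ^ L * (n ^ k) ^ L * r ^ n * q ^ (L * L)  ≡⟨ cong (_* q ^ (L * L)) events≡ ⟩
  (n ^ k * n ^ k * r ^ k) ^ L * q ^ (L * L)        <⟨ *-monoˡ-< (q ^ (L * L)) {{m^n≢0 q (L * L) {{>-nonZero 1≤q}}}} (^-monoˡ-< L {{>-nonZero 1≤L}} small) ⟩
  (2 ^ w) ^ L * q ^ (L * L)                        ≡⟨ cong₂ _*_ (^-*-assoc 2 w L) (trans (cong (q ^_) L²≡) (sym (^-*-assoc q (suc q) (w * L)))) ⟩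
  2 ^ (w * L) * (q ^ suc q) ^ (w * L)              ≡⟨ ^-distribʳ-* (w * L) 2 (q ^ suc q) ⟨
  (2 * q ^ suc q) ^ (w * L)                        ≤⟨ ^-monoˡ-≤ (w * L) (2*q^[1+q]≤[1+q]^[1+q] q) ⟩
  (suc q ^ suc q) ^ (w * L)                        ≡⟨ trans (^-*-assoc (suc q) (suc q) (w * L)) (cong (suc q ^_) (sym L²≡)) ⟩
  suc q ^ (L * L)                                  ∎
  where
  open ≤-Reasoning
  L²≡ : L * L ≡ suc q * (w * L)
  L²≡ = trans (cong (_* L) L≡) (*-assoc (suc q) w L)
  events≡ : (n ^ k) ^ L * (n ^ k) ^ L * r ^ n ≡ (n ^ k * n ^ k * r ^ k) ^ L
  events≡ = begin-equality
    (n ^ k) ^ L * (n ^ k) ^ L * r ^ n        ≡⟨ cong₂ _*_ (sym (^-distribʳ-* L (n ^ k) (n ^ k))) (trans (cong (r ^_) n≡kL) (sym (^-*-assoc r k L))) ⟩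
    (n ^ k * n ^ k) ^ L * (r ^ k) ^ L        ≡⟨ ^-distribʳ-* L (n ^ k * n ^ k) (r ^ k) ⟨
    (n ^ k * n ^ k * r ^ k) ^ L              ∎

-- With T = tm, Λ = Lm and σ = (1+q)m this says a + dm < 2nm. Put P = 1 + p and multiply by P: the
-- coefficient of Λ becomes (2P - 1)(16P + 2) + 4P = 32P² - 8P - 2 on the left against 32P² on the
-- right. The surplus (8P + 2)Λ, with Λ ≥ 5Pσ, pays for the terms in σ and for the rounding error P.
lists-fit : ∀ p a T Λ σ → a * suc p + T < (2 * T + 1) * suc p → T ≤ (16 * suc p + 2) * (Λ + σ) →
  5 * suc p * σ ≤ Λ → 1 ≤ σ → a + 4 * Λ < 32 * suc p * Λ
lists-fit p a T Λ σ rounding T≤ Λ≥ 1≤σ = ≰⇒> λ big → <-irrefl refl (begin-strict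
    32 * suc p * Λ * suc p                                               ≤⟨ *-monoˡ-≤ (suc p) big ⟩
    (a + 4 * Λ) * suc p                                                  ≡⟨ distrib a Λ p ⟩
    a * suc p + 4 * suc p * Λ                                            <⟨ +-monoˡ-< (4 * suc p * Λ) rounding′ ⟩
    (2 * p + 1) * T + suc p + 4 * suc p * Λ                              ≤⟨ +-monoˡ-≤ (4 * suc p * Λ) (+-monoˡ-≤ (suc p) (*-monoʳ-≤ (2 * p + 1) T≤)) ⟩
    (2 * p + 1) * ((16 * suc p + 2) * (Λ + σ)) + suc p + 4 * suc p * Λ   ≤⟨ final ⟩
    32 * suc p * Λ * suc p                                               ∎)
  where
  open ≤-Reasoning
  distrib : ∀ a Λ p → (a + 4 * Λ) * (1 + p) ≡ a * (1 + p) + 4 * (1 + p) * Λ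
  distrib = solve-∀
  split : ∀ T p → (2 * T + 1) * (1 + p) ≡ (2 * p + 1) * T + (1 + p) + T
  split = solve-∀
  rounding′ : a * suc p < (2 * p + 1) * T + suc p
  rounding′ = +-cancelʳ-< T (a * suc p) ((2 * p + 1) * T + suc p) (subst (a * suc p + T <_) (split T p) rounding)
  -- Substituting σ = 1 + s and Λ = 5Pσ + δ turns the surplus into the parenthesised polynomial,
  -- whose coefficients are all positive.
  slack : ∀ p s δ → let P = 1 + p ; σ = 1 + s ; Λ = 5 * P * σ + δ in
    (2 * p + 1) * ((16 * P + 2) * (Λ + σ)) + P + 4 * P * Λ
      + (8 * P * P + 21 * P + 2 + (8 * P * P + 22 * P + 2) * s + (8 * P + 2) * δ) ≡ 32 * P * Λ * P
  slack = solve-∀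
  final : (2 * p + 1) * ((16 * suc p + 2) * (Λ + σ)) + suc p + 4 * suc p * Λ ≤ 32 * suc p * Λ * suc p
  final with m≤n⇒∃[o]m+o≡n 1≤σ | m≤n⇒∃[o]m+o≡n Λ≥
  ... | s , refl | δ , refl = m+n≤o⇒m≤o _ (≤-reflexive (slack p s δ))

-- 1 / (1 + p) is a lower bound for ε. The cliques have n = kL vertices, each vertex of B has at most
-- d = n / r = 4L non-neighbours, and t is about (k + 2)L.
module Construction (p r k q w t m : ℕ) (r≡ : r ≡ 4 * suc p) (k≡ : k ≡ 16 * suc p)
  (r^k²≤1+q : r ^ (k * k) ≤ suc q) (1≤q : 1 ≤ q) (5p≤w : 5 * suc p ≤ w) (1≤m : 1 ≤ m)
  (t≥ : w * ((2 + k) * suc q) ≤ t) (t≤ : t ≤ suc w * ((2 + k) * suc q))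
  (exponential : (k * suc q) ^ k * (k * suc q) ^ k * r ^ k * w ^ (k + k) < 2 ^ w) where

  L n d P : ℕ
  -- A multiple of `suc q`, so that the `L * L` rectangles fall into `w * L` groups of `suc q`, each
  -- of which halves the proportion of bad colourings.
  L = suc q * w
  n = k * L
  d = 4 * L
  -- One colour fewer than `n + n` disjoint sets of size `m` require.
  P = pred ((n + n) * m)

  open ≤-Reasoning

  1≤L : 1 ≤ L
  1≤L = *-mono-≤ {1} {suc q} (s≤s z≤n) (≤-trans (s≤s z≤n) 5p≤w)

  n≡rd : n ≡ r * d
  n≡rd = trans (cong (_* L) k≡) (trans (regroup (suc p) L) (cong (_* d) (sym r≡)))
    where
    regroup : ∀ x L → 16 * x * L ≡ 4 * x * (4 * L)
    regroup = solve-∀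

  1≤r : 1 ≤ r
  1≤r = subst (1 ≤_) (sym r≡) (s≤s z≤n)

  n<r[1+d] : n < r * suc d
  n<r[1+d] = subst (_< r * suc d) (sym n≡rd) (*-monoʳ-< r {{>-nonZero 1≤r}} (n<1+n d))

  n+2L≤t : n + (L + L) ≤ t
  n+2L≤t = subst (_≤ t) (regroup w k (suc q)) t≥
    where
    regroup : ∀ w k s → w * ((2 + k) * s) ≡ k * (s * w) + (s * w + s * w)
    regroup = solve-∀

  small : n ^ k * n ^ k * r ^ k < 2 ^ w
  small = subst (_< 2 ^ w) (sym eq) exponential
    where
    regroup : ∀ x y z → x * y * (x * y) * z ≡ x * x * z * (y * y)
    regroup = solve-∀
    n^k≡ : n ^ k ≡ (k * suc q) ^ k * w ^ k
    n^k≡ = trans (cong (_^ k) (sym (*-assoc k (suc q) w))) (^-distribʳ-* k (k * suc q) w)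
    eq : n ^ k * n ^ k * r ^ k ≡ (k * suc q) ^ k * (k * suc q) ^ k * r ^ k * w ^ (k + k)
    eq = begin-equality
      n ^ k * n ^ k * r ^ k                                                      ≡⟨ cong (λ z → z * z * r ^ k) n^k≡ ⟩
      (k * suc q) ^ k * w ^ k * ((k * suc q) ^ k * w ^ k) * r ^ k                ≡⟨ regroup ((k * suc q) ^ k) (w ^ k) (r ^ k) ⟩
      (k * suc q) ^ k * (k * suc q) ^ k * r ^ k * (w ^ k * w ^ k)                ≡⟨ cong ((k * suc q) ^ k * (k * suc q) ^ k * r ^ k *_) (^-distribˡ-+-* w k k) ⟨
      (k * suc q) ^ k * (k * suc q) ^ k * r ^ k * w ^ (k + k)                    ∎

  colouring : ∃ λ (f : Fin n → Fin n → Fin r) → Unavoidable k L f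
  colouring = RandomColouring.unavoidable-exists n k L r q r^k²≤1+q
    (few-events n k L r q w refl refl 1≤q 1≤L small) 1≤r

  module WithColouring (f : Fin n → Fin n → Fin r) (unavoidable : Unavoidable k L f) where

    rare : ∀ b → ∃ λ c → count (λ a → f a b ≟ᶠ c) ≤ d
    rare b = rare-colour (λ a → f a b) n<r[1+d]

    -- The rare colour at `b` depends on `f`, which is why `Unavoidable` ranges over every selection
    -- of colours.
    F : Fin n → Fin n → Set
    F a b = f a b ≡ proj₁ (rare b)

    F? : ∀ a b → Dec (F a b)
    F? a b = f a b ≟ᶠ proj₁ (rare b)

    open Glued n ((P ^ m) ^ n) F F? using (order; graph; no-minor)

    minor-free : ¬ (K t IsMinorOf graph)
    minor-free = no-minor ≤-refl n+2L≤t 1≤L (unavoidable (proj₁ ∘ rare))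

    not-choosable : ∀ a → a * suc p + t * m < (2 * (t * m) + 1) * suc p → ¬ Choosable graph a m
    not-choosable a rounding =
      ListColouring.not-choosable n m a d P F F? (λ b → proj₂ (rare b)) (≤-pred′ a+dm<2nm) (pred< a+dm<2nm)
      where
      ≤-pred′ : ∀ {x y} → x < y → x ≤ pred y
      ≤-pred′ (s≤s x≤y) = x≤y
      pred< : ∀ {x y} → x < y → pred y < y
      pred< (s≤s _) = ≤-refl
      T≤ : t * m ≤ (16 * suc p + 2) * (L * m + suc q * m)
      T≤ = begin
        t * m                                         ≤⟨ *-monoˡ-≤ m t≤ ⟩
        suc w * ((2 + k) * suc q) * m                 ≡⟨ cong (λ z → suc w * ((2 + z) * suc q) * m) k≡ ⟩
        suc w * ((2 + 16 * suc p) * suc q) * m        ≡⟨ regroup w (suc p) (suc q) m ⟩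
        (16 * suc p + 2) * (L * m + suc q * m)        ∎
        where
        regroup : ∀ w x s m → (1 + w) * ((2 + 16 * x) * s) * m ≡ (16 * x + 2) * (s * w * m + s * m)
        regroup = solve-∀
      Λ≥ : 5 * suc p * (suc q * m) ≤ L * m
      Λ≥ = begin
        5 * suc p * (suc q * m)  ≤⟨ *-monoˡ-≤ (suc q * m) 5p≤w ⟩
        w * (suc q * m)          ≡⟨ regroup w (suc q) m ⟩
        L * m                    ∎
        where
        regroup : ∀ w s m → w * (s * m) ≡ s * w * m
        regroup = solve-∀
      a+dm<2nm : a + d * m < (n + n) * m
      a+dm<2nm = begin-strict
        a + d * m                ≡⟨ cong (a +_) (*-assoc 4 L m) ⟩
        a + 4 * (L * m)          <⟨ lists-fit p a (t * m) (L * m) (suc q * m) rounding T≤ Λ≥ (*-mono-≤ {1} {suc q} (s≤s z≤n) 1≤m) ⟩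
        32 * suc p * (L * m)     ≡⟨ regroup (suc p) L m ⟩
        (16 * suc p * L + 16 * suc p * L) * m  ≡⟨ cong (λ z → (z * L + z * L) * m) k≡ ⟨
        (n + n) * m              ∎
        where
        regroup : ∀ x L m → 32 * x * (L * m) ≡ (16 * x * L + 16 * x * L) * m
        regroup = solve-∀

  graph-exists : ∃ λ (N : ℕ) → Σ (Graph N) λ G → ¬ (K t IsMinorOf G) ×
    (∀ a → a * suc p + t * m < (2 * (t * m) + 1) * suc p → ¬ Choosable G a m)
  graph-exists = let f , unavoidable = colouring
                     module W = WithColouring f unavoidable
                 in _ , _ , W.minor-free , W.not-choosable

-- The threshold is fixed before `m` and so serves all `m`; the condition on `a` is the form that
-- `rounding-bound` gives to the real bound.
NonChoosableAbove : ℕ → ℕ → Set₁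
NonChoosableAbove p t₀ = (m : ℕ) → 1 ≤ m → (t : ℕ) → t₀ ≤ t → ∃ λ (N : ℕ) → Σ (Graph N) λ G → ¬ (K t IsMinorOf G) ×
  (∀ a → a * suc p + t * m < (2 * (t * m) + 1) * suc p → ¬ Choosable G a m)

threshold : ∀ p r k q → r ≡ 4 * suc p → k ≡ 16 * suc p → r ^ (k * k) ≤ suc q → 1 ≤ q → ∃ (NonChoosableAbove p)
threshold p r k q r≡ k≡ r^k²≤1+q 1≤q
  with polynomial<exponential (k + k) ((k * suc q) ^ k * (k * suc q) ^ k * r ^ k)
-- `w` is the quotient of `t` by `B`, and `B * w` equals (k + 2)L. Of the summands of the threshold,
-- `w₀` ensures the exponential bound and `5 * suc p` the room needed in `lists-fit`.
... | w₀ , bound = (w₀ + 5 * suc p) * B , λ m 1≤m t t₀≤t →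
    let w≥ = subst (_≤ t / B) (m*n/n≡m (w₀ + 5 * suc p) B) (/-monoˡ-≤ B t₀≤t) in
    Construction.graph-exists p r k q (t / B) t m r≡ k≡ r^k²≤1+q 1≤q
      (≤-trans (m≤n+m (5 * suc p) w₀) w≥) 1≤m (m/n*n≤m t B)
      (subst (_≤ suc (t / B) * B) (sym (m≡m%n+[m/n]*n t B)) (+-monoˡ-≤ (t / B * B) (m%n≤n t B)))
      (bound (t / B) (≤-trans (m≤m+n w₀ (5 * suc p)) w≥))
  where
  B : ℕ
  B = (2 + k) * suc q

threshold-exists : ∀ p → ∃ (NonChoosableAbove p)
threshold-exists p = go (4 * suc p) (16 * suc p) refl refl
  where
  go : ∀ r k → r ≡ 4 * suc p → k ≡ 16 * suc p → ∃ (NonChoosableAbove p)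
  -- Taking `q` to be `r ^ (k * k)` satisfies the bound on block contents and is positive as `r` is.
  go r k r≡ k≡ = threshold p r k (r ^ (k * k)) r≡ k≡ (n≤1+n (r ^ (k * k)))
    (m^n>0 r {{>-nonZero (subst (1 ≤_) (sym r≡) (s≤s z≤n))}} (k * k))

theorem5 : (ε : ℝ) → 0ℚ <ˡ ε → ε <ᵘ 1ℚ →
    ∃ λ (t₀ : ℕ) → (m : ℕ) → 1 ≤ m → (t : ℕ) → t₀ ≤ t →
    ∃ λ (n : ℕ) → Σ (Graph n) λ G →
    ¬ (K t IsMinorOf G) ×
    ((a : ℕ) → IsRoundingOf a ((fromℕ 2 − ε) · (t * m)) → ¬ Choosable G a m)
theorem5 ε 0<ε _ = let p , bound = rounding-bound ε 0<ε in conclude bound (threshold-exists p)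
  where
  conclude : ∀ {p} → (∀ a T → IsRoundingOf a ((fromℕ 2 − ε) · T) → a * suc p + T < (2 * T + 1) * suc p) →
    ∃ (NonChoosableAbove p) → _
  conclude bound (t₀ , exists) = t₀ , λ m 1≤m t t₀≤t →
    let N , G , minor-free , not-choosable = exists m 1≤m t t₀≤t
    in N , G , minor-free , λ a rounding → not-choosable a (bound a (t * m) rounding)
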